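{- Let $G$ be the two-element group $(\mathbb{Z}_2,+)$. For every integer $n\ge0$, there is a bijection between the set of permutations in $\mathcal{S}_{n+1}$ that avoid the partially ordered generalized pattern $3$-$121$-$3$ and the set of partial $G$-partitions of $[n]$.
   Context: $[n]=\{1,\dots,n\}$; $\mathcal{S}_n$ is the set of permutations of $[n]$, written as words $a_1\dots a_n$. A partially ordered generalized pattern is a word $p_1p_2\dots p_m$ of positive integers (repetitions allowed) with a dash written between some of the consecutive letters. An occurrence of it in $\pi=a_1\dots a_n$ is a subsequence $a_{k_1}\dots a_{k_m}$, $k_1<\dots<k_m$, such that (a) $p_i>p_j$ implies $a_{k_i}>a_{k_j}$ for all $i,j$ (no condition when $p_i=p_j$), and (b) $k_{i+1}=k_i+1$ whenever $p_i$ and $p_{i+1}$ are not separated by a dash. $\pi$ avoids the pattern if it has no occurrence. For a group $G$, a $G$-labeled set $(A,\alpha)$ is a set $A$ together with a map $\alpha:A\to G$. Two $G$-labeled sets $(A,\alpha)$ and $(A,\beta)$ on the same set are equivalent if there is $g\in G$ with $\alpha=g\beta$ (i.e. $\alpha(a)=g\cdot\beta(a)$ for all $a\in A$; for $G=\mathbb{Z}_2$ written additively, $\alpha(a)=g+\beta(a)$). $[A,\alpha]$ denotes the equivalence class of $(A,\alpha)$. A partial $G$-partition of a set $S$ is a set $\{[A_1,\alpha_1],\dots,[A_k,\alpha_k]\}$ (with $k\ge0$) where $A_1,\dots,A_k$ are nonempty pairwise disjoint subsets of $S$ (their union need not be all of $S$). -}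

module Defs where

open import Level using (Level; _⊔_; 0ℓ)
open import Algebra.Bundles using (Group)
import Algebra.Properties.Group as GroupProperties
open import Data.Bool.Base using (Bool; true; false)
open import Data.Fin.Base using (Fin; suc; inject₁; toℕ; _<_)
open import Data.Fin.Permutation using (Permutation′; _⟨$⟩ʳ_; _≈_)
open import Data.Fin.Subset using (Subset; _∈_; _∩_; Nonempty; Empty)
open import Data.List.Base using (List)
import Data.List.Relation.Binary.Subset.Setoid.Properties as ListSubset
open import Data.List.Relation.Unary.All using (All)
open import Data.List.Relation.Unary.AllPairs using (AllPairs)
open import Data.Nat.Base as ℕ using (ℕ; NonZero)
open import Data.Parity.Properties using (+-0-group)
open import Data.Product.Base using (Σ; ∃; _×_; _,_; proj₁)
open import Data.Vec.Base using (Vec; []; _∷_; lookup)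
import Data.Vec.Relation.Unary.All as VecAll
open import Relation.Binary.Bundles using (Setoid)
open import Relation.Binary.Definitions using (Monotonic₁)
import Relation.Binary.Construct.On as On
open import Relation.Binary.Properties.Preorder using (InducedEquivalence)
open import Relation.Binary.PropositionalEquality.Core
  using (_≡_; refl; sym; trans; subst)
open import Relation.Nullary.Negation.Core using (¬_)

private
  variable
    c ℓ : Level
    k n : ℕ

-- A word of k + 1 letters. Entry i of dashes tells whether a dash is
-- written between the letters at positions inject₁ i and suc i.
record POGP (k : ℕ) : Set where
  field
    letters  : Vec ℕ (ℕ.suc k)
    dashes   : Vec Bool k
    positive : VecAll.All NonZero letters

record Occurrence (p : POGP k) (π : Permutation′ n) : Set where
  open POGP p
  field
    position   : Fin (ℕ.suc k) → Fin n
    increasing : Monotonic₁ _<_ _<_ position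
    ordered    : ∀ i j → lookup letters i ℕ.> lookup letters j →
                 π ⟨$⟩ʳ position j < π ⟨$⟩ʳ position i
    adjacent   : ∀ i → lookup dashes i ≡ false →
                 toℕ (position (suc i)) ≡ ℕ.suc (toℕ (position (inject₁ i)))

Avoids : POGP k → Permutation′ n → Set
Avoids p π = ¬ Occurrence p π

permutationSetoid : ℕ → Setoid 0ℓ 0ℓ
permutationSetoid n = record
  { Carrier       = Permutation′ n
  ; _≈_           = _≈_
  ; isEquivalence = record
    { refl  = λ _ → refl
    ; sym   = λ π≈ρ i → sym (π≈ρ i)
    ; trans = λ π≈ρ ρ≈σ i → trans (π≈ρ i) (ρ≈σ i)
    }
  }

avoiders : POGP k → ℕ → Setoid 0ℓ 0ℓ
avoiders p n = On.setoid {B = Σ (Permutation′ n) (Avoids p)}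
                         (permutationSetoid n) proj₁

3-121-3 : POGP 4
3-121-3 = record
  { letters  = 3 ∷ 1 ∷ 2 ∷ 1 ∷ 3 ∷ []
  ; dashes   = true ∷ false ∷ false ∷ true ∷ []
  ; positive = _ VecAll.∷ _ VecAll.∷ _ VecAll.∷ _ VecAll.∷ _ VecAll.∷ VecAll.[]
  }

module _ (G : Group c ℓ) where
  open Group G
    using (Carrier; _∙_; ε; _⁻¹; assoc; identityˡ; ∙-congˡ)
    renaming (_≈_ to _≈ᴳ_; sym to symᴳ; trans to transᴳ)

  -- The membership proof is irrelevant, so that a label depends only on
  -- the element.
  record LabeledSet (n : ℕ) : Set c where
    field
      set   : Subset n
      label : ∀ i → .(i ∈ set) → Carrier

  open LabeledSet

  _∼_ : LabeledSet n → LabeledSet n → Set (c ⊔ ℓ)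
  X ∼ Y = set X ≡ set Y ×
          ∃ λ g → ∀ i (i∈X : i ∈ set X) (i∈Y : i ∈ set Y) →
                  label X i i∈X ≈ᴳ g ∙ label Y i i∈Y

  ∼-refl : {X : LabeledSet n} → X ∼ X
  ∼-refl = refl , ε , λ _ _ _ → symᴳ (identityˡ _)

  ∼-sym : {X Y : LabeledSet n} → X ∼ Y → Y ∼ X
  ∼-sym (X≡Y , g , α≈gβ) = sym X≡Y , g ⁻¹ , λ i i∈Y i∈X →
    transᴳ (symᴳ (GroupProperties.\\-leftDividesʳ G g _))
           (∙-congˡ (symᴳ (α≈gβ i i∈X i∈Y)))

  ∼-trans : {X Y Z : LabeledSet n} → X ∼ Y → Y ∼ Z → X ∼ Z
  ∼-trans (X≡Y , g , α≈gβ) (Y≡Z , h , β≈hγ) =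
    trans X≡Y Y≡Z , g ∙ h , λ i i∈X i∈Z →
      let i∈Y = subst (i ∈_) X≡Y i∈X in
      transᴳ (α≈gβ i i∈X i∈Y)
             (transᴳ (∙-congˡ (β≈hγ i i∈Y i∈Z)) (symᴳ (assoc g h _)))

  -- The elements of this setoid are the classes [A, α].
  labeledSetClasses : ℕ → Setoid c (c ⊔ ℓ)
  labeledSetClasses n = record
    { Carrier       = LabeledSet n
    ; _≈_           = _∼_
    ; isEquivalence = record
      { refl  = λ {X} → ∼-refl {X = X}
      ; sym   = λ {X} {Y} → ∼-sym {X = X} {Y}
      ; trans = λ {X} {Y} {Z} → ∼-trans {X = X} {Y} {Z}
      }
    }

  record PartialPartition (n : ℕ) : Set c where
    field
      blocks   : List (LabeledSet n)
      nonempty : All (λ X → Nonempty (set X)) blocks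
      disjoint : AllPairs (λ X Y → Empty (set X ∩ set Y)) blocks

  open PartialPartition

  -- A partial partition is a set of classes: two lists of blocks are
  -- identified when each is contained in the other up to _∼_.
  partialPartitions : ℕ → Setoid c (c ⊔ ℓ)
  partialPartitions n = On.setoid {B = PartialPartition n}
    (InducedEquivalence (ListSubset.⊆-preorder (labeledSetClasses n))) blocks

ℤ₂ : Group 0ℓ 0ℓ
ℤ₂ = +-0-group

{-# OPTIONS --safe #-}

-- Read outwards from its maximum, each half of an avoiding permutation is cut
-- after the successive maxima of what remains: an occurrence of 3-121-3 is
-- exactly a peak that is neither the maximum of the permutation nor the last
-- entry of its piece. Hence the permutation avoids the pattern iff every piece
-- decreases and then increases up to its last, largest entry. A piece is thus
-- given by its set of entries, its half, and, for each entry other than the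
-- least and the largest, whether it precedes or follows the least one. Storing
-- the half as the label of the least entry and normalising the label of the
-- largest entry to 0 turns the pieces with at least two entries into classes of
-- ℤ₂-labeled sets, and the half of a one-entry piece tells whether that entry
-- is a singleton block or belongs to no block.

module Submission where

open import Defs
open import Data.Bool.Base using (if_then_else_)
open import Data.Empty using (⊥)
open import Data.Fin.Base
  using (Fin; zero; suc; toℕ; _≤_; _<_; fromℕ; inject₁; fromℕ<; punchOut)
open import Data.Fin.Patterns using (0F; 1F; 2F; 3F; 4F)
open import Data.Fin.Permutation as Perm
  using (Permutation′; permutation; flip; _∘ₚ_; _⟨$⟩ʳ_; _⟨$⟩ˡ_; inverseˡ; inverseʳ)
import Data.Fin.Properties as Fin
open import Data.Fin.Subset using (Subset; _∈_; ∣_∣; _∩_; Empty)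
import Data.Fin.Subset.Properties as Subset
open import Data.Integer.Base as ℤ using (ℤ; +_; -[1+_]; +0; -<-; -<+; +<+)
import Data.Integer.Properties as ℤ
open import Data.List.Base using (List; _∷_; map; filter; allFin)
open import Data.List.Membership.Propositional using (find; lose)
open import Data.List.Membership.Propositional.Properties
  using (∈-filter⁺; ∈-filter⁻; ∈-allFin)
import Data.List.Membership.Setoid as Membership
import Data.List.Relation.Unary.All as All
import Data.List.Relation.Unary.All.Properties as All
open import Data.List.Relation.Unary.AllPairs as AllPairs using (AllPairs; _∷_)
import Data.List.Relation.Unary.AllPairs.Properties as AllPairs
open import Data.List.Relation.Unary.Any as Any using (here; there)
import Data.List.Relation.Unary.Any.Properties as Any
import Data.List.Relation.Unary.Unique.Propositional.Properties as Unique
open import Data.Nat.Base as ℕ using (ℕ; suc; z≤n; s≤s; z<s; _+_; _*_; _∸_; ∣_-_∣)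
import Data.Nat.Properties as ℕ
open import Data.Parity.Base as ℙ using (Parity; 0ℙ; 1ℙ)
import Data.Parity.Properties as ℙ
open import Data.Product.Base using (∃; _×_; _,_; proj₁; proj₂; map₂)
open import Data.Sum.Base using (_⊎_; inj₁; inj₂)
open import Data.Vec.Base using (tabulate; lookup; []; _∷_)
open import Data.Vec.Properties using (lookup∘tabulate; []=⇒lookup; lookup⇒[]=)
open import Function.Base using (_∘_)
open import Function.Bundles using (Bijection)
open import Function.Definitions using (Injective)
open import Level using (Level)
open import Relation.Binary.Bundles using (Setoid)
open import Relation.Binary.Definitions using (tri<; tri≈; tri>; Monotonic₁)
open import Relation.Binary.PropositionalEquality
  using (_≡_; _≢_; refl; sym; trans; cong; cong₂; subst; subst₂; module ≡-Reasoning)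
open import Relation.Nullary
  using (¬_; ¬?; Dec; yes; no; does; _×-dec_; _⊎-dec_; contradiction)
open import Relation.Nullary.Decidable using (decidable-stable; dec-true; dec-false)
open import Relation.Unary using (Pred; Decidable)

private
  variable
    p : Level
    k n : ℕ

-- One of the two 3s costs nothing: on the side of a peak that faces the maximum of the permutation,
-- that maximum serves. The other 3 must lie further out, and a larger entry further out exists
-- exactly when the peak does not end its piece. A count explains the encoding. The order of the
-- pieces in a half is forced, since their last entries decrease outwards. In a piece of m >= 2
-- entries, the m - 2 entries other than the least and the largest choose freely on which side of
-- the least one they stand, and the piece chooses a half: 2^(m-1) possibilities, as many as the
-- ℤ₂-labelings of m elements up to a common shift. For m = 1 there are two halves but a single
-- class, so the spare possibility has to mean an element left out. Both ends of the bijection are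
-- setoids with many representatives; `Coding` is the rigid middle term between them.

least : {P : Pred (Fin n) p} → Decidable P → ∃ P →
        ∃ λ m → P m × ∀ {j} → P j → m ≤ j
least {suc n} P? (i , Pi) with P? zero
least         P? (i , Pi)     | yes P0 = zero , P0 , λ _ → z≤n
least         P? (zero , P0)  | no ¬P0 = contradiction P0 ¬P0
least         P? (suc i , Pi) | no ¬P0 with least (P? ∘ suc) (i , Pi)
... | m , Pm , m≤ = suc m , Pm ,
  λ { {zero} P0 → contradiction P0 ¬P0 ; {suc j} Pj → s≤s (m≤ Pj) }

greatest : {P : Pred (Fin n) p} → Decidable P → ∃ P →
           ∃ λ m → P m × ∀ {j} → P j → j ≤ m
greatest {suc n} P? (i , Pi) with Fin.any? (P? ∘ suc)
greatest P? (i , Pi)     | yes ∃P with greatest (P? ∘ suc) ∃P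
... | m , Pm , ≤m = suc m , Pm , λ { {zero} _ → z≤n ; {suc j} Pj → s≤s (≤m Pj) }
greatest P? (suc i , Pi) | no ¬∃P = contradiction (i , Pi) ¬∃P
greatest P? (zero , P0)  | no ¬∃P = zero , P0 ,
  λ { {zero} _ → z≤n ; {suc j} Pj → contradiction (j , Pj) ¬∃P }

-- Two-digit numerals in base `R`, decided at the leading digit. This makes `key` lexicographic: top
-- first, then `weight`.
*-+-lex-< : ∀ {a b r} s {R} → a ℕ.< b → r ℕ.< R → a * R + r ℕ.< b * R + s
*-+-lex-< {a} {b} {r} s {R} a<b r<R = begin-strict
  a * R + r   <⟨ ℕ.+-monoʳ-< (a * R) r<R ⟩
  a * R + R   ≡⟨ ℕ.+-comm (a * R) R ⟩
  suc a * R   ≤⟨ ℕ.*-monoˡ-≤ R a<b ⟩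
  b * R       ≤⟨ ℕ.m≤m+n (b * R) s ⟩
  b * R + s   ∎
  where open ℕ.≤-Reasoning

-- Codings, layouts and their pieces

NonLeast : (Fin n → Fin n) → Fin n → Set
NonLeast t i = ∃ λ j → j < i × t j ≡ t i

nonLeast? : (t : Fin n → Fin n) → Decidable (NonLeast t)
nonLeast? t i = Fin.any? λ j → j Fin.<? i ×-dec t j Fin.≟ t i

-- A partial ℤ₂-partition in normal form: top i is the largest element of the
-- block of i, where labels are normalised to 0ℙ. An element that is alone has
-- label 1ℙ if it is a singleton block and 0ℙ if it belongs to no block.
record Coding (n : ℕ) : Set where
  field
    top       : Fin n → Fin n
    label     : Fin n → Parity
    i≤top     : ∀ i → i ≤ top i
    top-idem  : ∀ i → top (top i) ≡ top i
    label-top : ∀ i {j} → j < top i → top j ≡ top i → label (top i) ≡ 0ℙ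

  bottom-of : ∀ i → ∃ λ b → top b ≡ top i × ∀ {j} → top j ≡ top i → b ≤ j
  bottom-of i = least (λ j → top j Fin.≟ top i) (i , refl)

  bottom : Fin n → Fin n
  bottom i = proj₁ (bottom-of i)

  top-bottom : ∀ i → top (bottom i) ≡ top i
  top-bottom i = proj₁ (proj₂ (bottom-of i))

  bottom-least : ∀ i → ¬ NonLeast top (bottom i)
  bottom-least i (j , j<b , eq) =
    ℕ.<⇒≱ j<b (proj₂ (proj₂ (bottom-of i)) (trans eq (top-bottom i)))

  bottom-cong : ∀ i j → top i ≡ top j → bottom i ≡ bottom j
  bottom-cong i j eq = Fin.≤-antisym
    (proj₂ (proj₂ (bottom-of i)) (trans (top-bottom j) (sym eq)))
    (proj₂ (proj₂ (bottom-of j)) (trans (top-bottom i) eq))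

  least⇒≡bottom : ∀ i → ¬ NonLeast top i → bottom i ≡ i
  least⇒≡bottom i ¬nl with Fin.<-cmp (bottom i) i
  ... | tri≈ _ eq _ = eq
  ... | tri< b<i _ _ = contradiction (bottom i , b<i , top-bottom i) ¬nl
  ... | tri> _ _ i<b = contradiction (i , i<b , sym (top-bottom i)) (bottom-least i)

open Coding

infix 4 _≋_ _≈ˡ_

_≋_ : Coding n → Coding n → Set
E ≋ F = (∀ i → top E i ≡ top F i) × (∀ i → label E i ≡ label F i)

≋-trans : {E F G : Coding n} → E ≋ F → F ≋ G → E ≋ G
≋-trans (t , l) (t′ , l′) = (λ i → trans (t i) (t′ i)) , (λ i → trans (l i) (l′ i))

-- The halves of a permutation to the left (0ℙ) and right (1ℙ) of its maximum n,
-- with the distances from that maximum; only their order will matter.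
record Layout (n : ℕ) : Set where
  field
    side      : Fin n → Parity
    distance  : Fin n → ℕ
    injective : ∀ {i j} → side i ≡ side j → distance i ≡ distance j → i ≡ j

  Beyond : Fin n → Fin n → Set
  Beyond i j = side j ≡ side i × distance i ℕ.≤ distance j

  private
    furthest : ∀ i → ∃ λ m → Beyond i m × ∀ {j} → Beyond i j → j ≤ m
    furthest i = greatest (λ j → side j ℙ.≟ side i ×-dec distance i ℕ.≤? distance j)
                        (i , refl , ℕ.≤-refl)

  -- The outermost entry of the piece containing i.
  blockMax : Fin n → Fin n
  blockMax i = proj₁ (furthest i)

  side-blockMax : ∀ i → side (blockMax i) ≡ side i
  side-blockMax i = proj₁ (proj₁ (proj₂ (furthest i)))

  distance-blockMax : ∀ i → distance i ℕ.≤ distance (blockMax i)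
  distance-blockMax i = proj₂ (proj₁ (proj₂ (furthest i)))

  beyond⇒≤blockMax : ∀ {i j} → Beyond i j → j ≤ blockMax i
  beyond⇒≤blockMax {i} = proj₂ (proj₂ (furthest i))

  i≤blockMax : ∀ i → i ≤ blockMax i
  i≤blockMax i = beyond⇒≤blockMax (refl , ℕ.≤-refl)

  blockMax-antitone : ∀ {i j} → Beyond i j → blockMax j ≤ blockMax i
  blockMax-antitone {i} {j} (s , d) =
    beyond⇒≤blockMax (trans (side-blockMax j) s , ℕ.≤-trans d (distance-blockMax j))

  blockMax-unique : ∀ {i m} → Beyond i m → (∀ {j} → Beyond i j → j ≤ m) → blockMax i ≡ m
  blockMax-unique {i} b u =
    Fin.≤-antisym (u (side-blockMax i , distance-blockMax i)) (beyond⇒≤blockMax b)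

  blockMax-idem : ∀ i → blockMax (blockMax i) ≡ blockMax i
  blockMax-idem i = Fin.≤-antisym (blockMax-antitone (side-blockMax i , distance-blockMax i))
                              (i≤blockMax (blockMax i))

  ≡blockMax⇒≡side : ∀ {i j} → blockMax i ≡ blockMax j → side i ≡ side j
  ≡blockMax⇒≡side {i} {j} eq =
    trans (sym (side-blockMax i)) (trans (cong side eq) (side-blockMax j))

  -- In a piece of a valid layout, these are the entries before the least one.
  Inner : Fin n → Set
  Inner i = ∃ λ j → j < i × blockMax j ≡ blockMax i × distance i ℕ.< distance j

  inner? : Decidable Inner
  inner? i = Fin.any? λ j →
    j Fin.<? i ×-dec blockMax j Fin.≟ blockMax i ×-dec distance i ℕ.<? distance j

  ¬inner-blockMax : ∀ i → ¬ Inner (blockMax i)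
  ¬inner-blockMax i (j , j<t , eq , d) =
    ℕ.<⇒≱ d (ℕ.≤-trans (distance-blockMax j)
      (ℕ.≤-reflexive (cong distance (trans eq (blockMax-idem i)))))

  -- The outermost entry gets 0ℙ automatically: nothing of its piece lies further out, so unless it
  -- is also the least it falls under the last clause.
  mark : Fin n → Parity
  mark i with nonLeast? blockMax i | inner? i
  ... | no  _ | _     = side i
  ... | yes _ | yes _ = 1ℙ
  ... | yes _ | no _  = 0ℙ

  mark-least : ∀ {i} → ¬ NonLeast blockMax i → mark i ≡ side i
  mark-least {i} ¬nl with nonLeast? blockMax i
  ... | no _   = refl
  ... | yes nl = contradiction nl ¬nl

  inner⇒nonLeast : ∀ {i} → Inner i → NonLeast blockMax i
  inner⇒nonLeast (j , j<i , eq , _) = j , j<i , eq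

  mark-inner : ∀ {i} → Inner i → mark i ≡ 1ℙ
  mark-inner {i} inn with nonLeast? blockMax i | inner? i
  ... | yes _  | yes _  = refl
  ... | no ¬nl | _      = contradiction (inner⇒nonLeast inn) ¬nl
  ... | yes _  | no ¬in = contradiction inn ¬in

  mark-outer : ∀ {i} → NonLeast blockMax i → ¬ Inner i → mark i ≡ 0ℙ
  mark-outer {i} nl ¬in with nonLeast? blockMax i | inner? i
  ... | yes _  | no _    = refl
  ... | no ¬nl | _       = contradiction nl ¬nl
  ... | yes _  | yes inn = contradiction inn ¬in

  -- Distinct numbers decrease and then increase iff none of them exceeds both an earlier and a
  -- later one. Stated without adjacency, this involves only the order of distances, so it transfers
  -- along `_≈ˡ_`.
  Valid : Set
  Valid = ∀ {i j k} → blockMax j ≡ blockMax i → blockMax k ≡ blockMax i →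
          distance j ℕ.< distance i → distance i ℕ.< distance k →
          j < i → ¬ k < i

open Layout

coding : Layout n → Coding n
coding L = record
  { top       = blockMax L
  ; label     = mark L
  ; i≤top     = i≤blockMax L
  ; top-idem  = blockMax-idem L
  ; label-top = λ i j<t eq →
      mark-outer L (_ , j<t , trans eq (sym (blockMax-idem L i))) (¬inner-blockMax L i)
  }

-- Distances read off a permutation and distances built from a coding differ as numbers, so layouts
-- are compared up to order on each side.
record _≈ˡ_ (L M : Layout n) : Set where
  constructor _,_
  field
    sides : ∀ i → side L i ≡ side M i
    order : ∀ {i j} → side L i ≡ side L j →
            distance L i ℕ.< distance L j → distance M i ℕ.< distance M j

open _≈ˡ_

-- By trichotomy: a comparison that failed in `L` would be an equality or reversed there, and `M`
-- excludes both.
≈ˡ-sym : {L M : Layout n} → L ≈ˡ M → M ≈ˡ L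
≈ˡ-sym {L = L} {M} L≈M .sides i = sym (sides L≈M i)
≈ˡ-sym {L = L} {M} L≈M .order {i} {j} s d
  with ℕ.<-cmp (distance L i) (distance L j)
... | tri< i<j _ _ = i<j
... | tri≈ _ eq _  = contradiction d (ℕ.<-irrefl (cong (distance M)
        (injective L (trans (sides L≈M i) (trans s (sym (sides L≈M j)))) eq)))
... | tri> _ _ j<i = contradiction d (ℕ.<-asym
        (order L≈M (trans (sides L≈M j) (trans (sym s) (sym (sides L≈M i)))) j<i))

≈ˡ-trans : {L M N : Layout n} → L ≈ˡ M → M ≈ˡ N → L ≈ˡ N
≈ˡ-trans L≈M M≈N .sides i   = trans (sides L≈M i) (sides M≈N i)
≈ˡ-trans L≈M M≈N .order {i} {j} s d = order M≈N
  (trans (sym (sides L≈M i)) (trans s (sides L≈M j))) (order L≈M s d)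

beyond-cong : {L M : Layout n} → L ≈ˡ M → ∀ {i j} → Beyond L i j → Beyond M i j
beyond-cong {L = L} {M} L≈M {i} {j} (s , d) =
  trans (sym (sides L≈M j)) (trans s (sides L≈M i)) , d′
  where
  d′ : distance M i ℕ.≤ distance M j
  d′ with ℕ.m≤n⇒m<n∨m≡n d
  ... | inj₁ lt = ℕ.<⇒≤ (order L≈M (sym s) lt)
  ... | inj₂ eq = ℕ.≤-reflexive (cong (distance M) (injective L (sym s) eq))

blockMax-cong : {L M : Layout n} → L ≈ˡ M → ∀ i → blockMax L i ≡ blockMax M i
blockMax-cong {L = L} {M} L≈M i = blockMax-unique L
  (beyond-cong (≈ˡ-sym L≈M) (side-blockMax M i , distance-blockMax M i))
  (beyond⇒≤blockMax M ∘ beyond-cong L≈M)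

valid-cong : {L M : Layout n} → L ≈ˡ M → Valid L → Valid M
valid-cong {L = L} {M} L≈M vL {i} {j} {k} eqj eqk d d′ =
  vL (e j eqj) (e k eqk) (order M≈L (≡blockMax⇒≡side M eqj) d)
     (order M≈L (≡blockMax⇒≡side M (sym eqk)) d′)
  where
  M≈L = ≈ˡ-sym L≈M
  e : ∀ j → blockMax M j ≡ blockMax M i → blockMax L j ≡ blockMax L i
  e j eq = trans (blockMax-cong L≈M j) (trans eq (sym (blockMax-cong L≈M i)))

mark-cong : {L M : Layout n} → L ≈ˡ M → ∀ i → mark L i ≡ mark M i
mark-cong {L = L} {M} L≈M i = go (nonLeast? (blockMax L) i) (inner? L i)
  where
  e : ∀ {L M} → L ≈ˡ M → ∀ j → blockMax L j ≡ blockMax L i → blockMax M j ≡ blockMax M i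
  e L≈M j eq = trans (sym (blockMax-cong L≈M j)) (trans eq (blockMax-cong L≈M i))
  nl : ∀ {L M} → L ≈ˡ M → NonLeast (blockMax L) i → NonLeast (blockMax M) i
  nl L≈M (j , lt , eq) = j , lt , e L≈M j eq
  inn : ∀ {L M} → L ≈ˡ M → Inner L i → Inner M i
  inn {L} L≈M (j , lt , eq , d) =
    j , lt , e L≈M j eq , order L≈M (≡blockMax⇒≡side L (sym eq)) d
  go : Dec (NonLeast (blockMax L) i) → Dec (Inner L i) → mark L i ≡ mark M i
  go (no ¬nl) _ = trans (mark-least L ¬nl)
    (trans (sides L≈M i) (sym (mark-least M (¬nl ∘ nl (≈ˡ-sym L≈M)))))
  go (yes _) (yes i∈) = trans (mark-inner L i∈) (sym (mark-inner M (inn L≈M i∈)))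
  go (yes y) (no i∉)  = trans (mark-outer L y i∉)
    (sym (mark-outer M (nl L≈M y) (i∉ ∘ inn (≈ˡ-sym L≈M))))

coding-cong : {L M : Layout n} → L ≈ˡ M → coding L ≋ coding M
coding-cong L≈M = blockMax-cong L≈M , mark-cong L≈M

-- Layouts from codings

module _ (E : Coding n) where

  InnerLabel : Fin n → Set
  InnerLabel i = NonLeast (top E) i × label E i ≡ 1ℙ

  innerLabel? : Decidable InnerLabel
  innerLabel? i = nonLeast? (top E) i ×-dec label E i ℙ.≟ 1ℙ

  ¬innerLabel-top : ∀ i → ¬ InnerLabel (top E i)
  ¬innerLabel-top i ((j , j<t , eq) , l) with () ←
    trans (sym l) (label-top E i j<t (trans eq (top-idem E i)))

  -- Inner entries take values below `n`, falling as the entry grows, and the others values from `n`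
  -- on, rising: a valley. All stay below `n + n`, the base used in `key`.
  weight : Fin n → ℕ
  weight i with innerLabel? i
  ... | yes _ = n ∸ suc (toℕ i)
  ... | no  _ = n + toℕ i

  weight-inner : ∀ {i} → InnerLabel i → weight i ≡ n ∸ suc (toℕ i)
  weight-inner {i} x with innerLabel? i
  ... | yes _ = refl
  ... | no ¬x = contradiction x ¬x

  weight-outer : ∀ {i} → ¬ InnerLabel i → weight i ≡ n + toℕ i
  weight-outer {i} ¬x with innerLabel? i
  ... | yes x = contradiction x ¬x
  ... | no  _ = refl

  weight-inner<n : ∀ {i} → InnerLabel i → weight i ℕ.< n
  weight-inner<n {i} x = subst (ℕ._< n) (sym (weight-inner x))
    (ℕ.∸-monoʳ-< {n} {suc (toℕ i)} {0} (s≤s z≤n) (Fin.toℕ<n i))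

  weight<n+n : ∀ i → weight i ℕ.< n + n
  weight<n+n i with innerLabel? i
  ... | yes _ = ℕ.≤-trans (ℕ.∸-monoʳ-< {n} {suc (toℕ i)} {0} (s≤s z≤n) (Fin.toℕ<n i))
                          (ℕ.m≤m+n n n)
  ... | no  _ = ℕ.+-monoʳ-< n (Fin.toℕ<n i)

  -- Comparison by cases instead of arithmetic: since `key-cmp` is total, `key-<⁻¹` recovers the
  -- case from an inequality of keys, and later proofs only match on constructors.
  data WeightOrder (i j : Fin n) : Set where
    inner-outer : InnerLabel i → ¬ InnerLabel j → WeightOrder i j
    inner-inner : InnerLabel i → InnerLabel j → j < i → WeightOrder i j
    outer-outer : ¬ InnerLabel i → ¬ InnerLabel j → i < j → WeightOrder i j

  weight-< : ∀ {i j} → WeightOrder i j → weight i ℕ.< weight j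
  weight-< {i} {j} (inner-outer x ¬y) = ℕ.<-≤-trans (weight-inner<n x)
    (subst (n ℕ.≤_) (sym (weight-outer ¬y)) (ℕ.m≤m+n n (toℕ j)))
  weight-< {i} {j} (inner-inner x y j<i) =
    subst₂ ℕ._<_ (sym (weight-inner x)) (sym (weight-inner y))
      (ℕ.∸-monoʳ-< (s≤s j<i) (Fin.toℕ<n i))
  weight-< (outer-outer ¬x ¬y i<j) =
    subst₂ ℕ._<_ (sym (weight-outer ¬x)) (sym (weight-outer ¬y)) (ℕ.+-monoʳ-< n i<j)

  weight-cmp : ∀ i j → WeightOrder i j ⊎ i ≡ j ⊎ WeightOrder j i
  weight-cmp i j with innerLabel? i | innerLabel? j | Fin.<-cmp i j
  ... | _      | _      | tri≈ _ eq _  = inj₂ (inj₁ eq)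
  ... | yes x  | no ¬y  | _            = inj₁ (inner-outer x ¬y)
  ... | no ¬x  | yes y  | _            = inj₂ (inj₂ (inner-outer y ¬x))
  ... | yes x  | yes y  | tri< i<j _ _ = inj₂ (inj₂ (inner-inner y x i<j))
  ... | yes x  | yes y  | tri> _ _ j<i = inj₁ (inner-inner x y j<i)
  ... | no ¬x  | no ¬y  | tri< i<j _ _ = inj₁ (outer-outer ¬x ¬y i<j)
  ... | no ¬x  | no ¬y  | tri> _ _ j<i = inj₂ (inj₂ (outer-outer ¬y ¬x j<i))

  -- Outwards, the pieces have decreasing tops, and within a piece the inner
  -- entries come first, in decreasing order, then the others, in increasing order.
  key : Fin n → ℕ
  key i = (n ∸ toℕ (top E i)) * (n + n) + weight i

  data KeyOrder (i j : Fin n) : Set where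
    top-> : top E j < top E i → KeyOrder i j
    top-≡ : top E i ≡ top E j → WeightOrder i j → KeyOrder i j

  key-< : ∀ {i j} → KeyOrder i j → key i ℕ.< key j
  key-< {i} {j} (top-> lt) = *-+-lex-< (weight j)
    (ℕ.∸-monoʳ-< lt (ℕ.<⇒≤ (Fin.toℕ<n (top E i)))) (weight<n+n i)
  key-< {i} {j} (top-≡ eq w) = subst (λ t → key i ℕ.< (n ∸ toℕ t) * (n + n) + weight j)
    eq (ℕ.+-monoʳ-< _ (weight-< w))

  key-cmp : ∀ i j → KeyOrder i j ⊎ i ≡ j ⊎ KeyOrder j i
  key-cmp i j with Fin.<-cmp (top E i) (top E j) | weight-cmp i j
  ... | tri< lt _ _ | _              = inj₂ (inj₂ (top-> lt))
  ... | tri> _ _ gt | _              = inj₁ (top-> gt)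
  ... | tri≈ _ eq _ | inj₁ w         = inj₁ (top-≡ eq w)
  ... | tri≈ _ eq _ | inj₂ (inj₁ e)  = inj₂ (inj₁ e)
  ... | tri≈ _ eq _ | inj₂ (inj₂ w)  = inj₂ (inj₂ (top-≡ (sym eq) w))

  key-<⁻¹ : ∀ {i j} → key i ℕ.< key j → KeyOrder i j
  key-<⁻¹ {i} {j} lt with key-cmp i j
  ... | inj₁ o           = o
  ... | inj₂ (inj₁ refl) = contradiction lt (ℕ.<-irrefl refl)
  ... | inj₂ (inj₂ o)    = contradiction lt (ℕ.<-asym (key-< o))

  key-injective : ∀ {i j} → key i ≡ key j → i ≡ j
  key-injective {i} {j} eq with key-cmp i j
  ... | inj₁ o          = contradiction (key-< o) (ℕ.<-irrefl eq)
  ... | inj₂ (inj₁ i≡j) = i≡j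
  ... | inj₂ (inj₂ o)   = contradiction (key-< o) (ℕ.<-irrefl (sym eq))

  -- `key` ranks the pieces of both halves together, which is harmless because only distances on one
  -- side are ever compared.
  layout : Layout n
  layout = record
    { side      = label E ∘ bottom E
    ; distance  = key
    ; injective = λ _ → key-injective
    }

  key-≤⇒top-≥ : ∀ {i j} → key i ℕ.≤ key j → top E j ≤ top E i
  key-≤⇒top-≥ le = ℕ.≮⇒≥ λ lt → ℕ.<⇒≱ (key-< (top-> lt)) le

  key-top : ∀ i → key i ℕ.≤ key (top E i)
  key-top i = go (innerLabel? i) (i Fin.≟ top E i)
    where
    go : Dec (InnerLabel i) → Dec (i ≡ top E i) → key i ℕ.≤ key (top E i)
    go _       (yes eq) = ℕ.≤-reflexive (cong key eq)
    go (yes x) (no _)   = ℕ.<⇒≤ (key-< (top-≡ (sym (top-idem E i))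
      (inner-outer x (¬innerLabel-top i))))
    go (no ¬x) (no neq) = ℕ.<⇒≤ (key-< (top-≡ (sym (top-idem E i))
      (outer-outer ¬x (¬innerLabel-top i) (Fin.≤∧≢⇒< (i≤top E i) neq))))

  -- Keys from that of `i` on belong to tops at most `top E i`, and no entry exceeds its own top;
  -- `top E i` itself comes last in its piece.
  blockMax-layout : ∀ i → blockMax layout i ≡ top E i
  blockMax-layout i = blockMax-unique layout
    ( cong (label E) (bottom-cong E _ _ (top-idem E i)) , key-top i )
    λ {j} (_ , d) → ℕ.≤-trans (i≤top E j) (key-≤⇒top-≥ d)

  blockMax⇒top : ∀ {i j} → blockMax layout i ≡ blockMax layout j → top E i ≡ top E j
  blockMax⇒top {i} {j} eq = trans (sym (blockMax-layout i)) (trans eq (blockMax-layout j))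

  top⇒blockMax : ∀ {i j} → top E i ≡ top E j → blockMax layout i ≡ blockMax layout j
  top⇒blockMax {i} {j} eq = trans (blockMax-layout i) (trans eq (sym (blockMax-layout j)))

  innerLabel⇒inner : ∀ {i} → InnerLabel i → Inner layout i
  innerLabel⇒inner {i} x@((j , j<i , eq) , _) =
    j , j<i , top⇒blockMax eq , key-< (top-≡ (sym eq) w)
    where
    w : WeightOrder i j
    w with innerLabel? j
    ... | yes y = inner-inner x y j<i
    ... | no ¬y = inner-outer x ¬y

  inner⇒innerLabel : ∀ {i} → Inner layout i → InnerLabel i
  inner⇒innerLabel (j , j<i , eq , d) with key-<⁻¹ d
  ... | top-> lt                    = contradiction lt (ℕ.<-irrefl (cong toℕ (blockMax⇒top eq)))
  ... | top-≡ _ (inner-outer x _)   = x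
  ... | top-≡ _ (inner-inner x _ _) = x
  ... | top-≡ _ (outer-outer _ _ i<j) = contradiction j<i (ℕ.<-asym i<j)

  mark-layout : ∀ i → mark layout i ≡ label E i
  mark-layout i = go (nonLeast? (top E) i) (innerLabel? i)
    where
    label≡0 : NonLeast (top E) i → ¬ InnerLabel i → ∀ l → label E i ≡ l → l ≡ 0ℙ
    label≡0 nl ¬x 0ℙ _ = refl
    label≡0 nl ¬x 1ℙ l = contradiction (nl , l) ¬x
    go : Dec (NonLeast (top E) i) → Dec (InnerLabel i) → mark layout i ≡ label E i
    go (no ¬nl) _ = trans
      (mark-least layout λ (j , j<i , eq) → ¬nl (j , j<i , blockMax⇒top eq))
      (cong (label E) (least⇒≡bottom E i ¬nl))
    go (yes _) (yes x) = trans (mark-inner layout (innerLabel⇒inner x)) (sym (proj₂ x))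
    go (yes nl@(j , j<i , eq)) (no ¬x) = trans
      (mark-outer layout (j , j<i , top⇒blockMax eq) (¬x ∘ inner⇒innerLabel))
      (sym (label≡0 nl ¬x _ refl))

  coding-layout : coding layout ≋ E
  coding-layout = blockMax-layout , mark-layout

  -- A smaller entry `j` nearer than `i` forces `i` out of the decreasing, inner part; from there on
  -- the piece increases, so `k` cannot be smaller.
  valid-layout : Valid layout
  valid-layout eqj eqk d d′ j<i k<i with key-<⁻¹ d | key-<⁻¹ d′
  ... | top-> lt | _ = ℕ.<-irrefl (cong toℕ (sym (blockMax⇒top eqj))) lt
  ... | _ | top-> lt = ℕ.<-irrefl (cong toℕ (blockMax⇒top eqk)) lt
  ... | top-≡ _ _ | top-≡ _ (outer-outer _ _ i<k)   = ℕ.<-asym i<k k<i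
  ... | top-≡ _ (inner-inner _ _ i<j) | top-≡ _ _   = ℕ.<-asym i<j j<i
  ... | top-≡ _ (inner-outer _ ¬x) | top-≡ _ (inner-outer x _)   = ¬x x
  ... | top-≡ _ (inner-outer _ ¬x) | top-≡ _ (inner-inner x _ _) = ¬x x
  ... | top-≡ _ (outer-outer _ ¬x _) | top-≡ _ (inner-outer x _)   = ¬x x
  ... | top-≡ _ (outer-outer _ ¬x _) | top-≡ _ (inner-inner x _ _) = ¬x x

layout-cong : {E F : Coding n} → E ≋ F → layout E ≈ˡ layout F
layout-cong {E = E} {F} (t , l) = record
  { sides = λ i → trans (l _) (cong (label F) (bottom-≡ i))
  ; order = λ _ → key-< F ∘ key-order ∘ key-<⁻¹ E
  }
  where
  e : ∀ {i j} → top E i ≡ top E j → top F i ≡ top F j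
  e {i} {j} eq = trans (sym (t i)) (trans eq (t j))
  e⁻¹ : ∀ {i j} → top F i ≡ top F j → top E i ≡ top E j
  e⁻¹ {i} {j} eq = trans (t i) (trans eq (sym (t j)))
  bottom-≡ : ∀ i → bottom E i ≡ bottom F i
  bottom-≡ i = trans
    (sym (least⇒≡bottom F _ λ (j , j<b , eq) → bottom-least E i (j , j<b , e⁻¹ eq)))
    (bottom-cong F _ _ (e (top-bottom E i)))
  inn : ∀ {i} → InnerLabel E i → InnerLabel F i
  inn ((j , j<i , eq) , x) = (j , j<i , e eq) , trans (sym (l _)) x
  inn⁻¹ : ∀ {i} → InnerLabel F i → InnerLabel E i
  inn⁻¹ ((j , j<i , eq) , x) = (j , j<i , e⁻¹ eq) , trans (l _) x
  weight-order : ∀ {i j} → WeightOrder E i j → WeightOrder F i j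
  weight-order (inner-outer x ¬y)    = inner-outer (inn x) (¬y ∘ inn⁻¹)
  weight-order (inner-inner x y lt)  = inner-inner (inn x) (inn y) lt
  weight-order (outer-outer ¬x ¬y lt) = outer-outer (¬x ∘ inn⁻¹) (¬y ∘ inn⁻¹) lt
  key-order : ∀ {i j} → KeyOrder E i j → KeyOrder F i j
  key-order {i} {j} (top-> lt) = top-> (subst₂ _<_ (t j) (t i) lt)
  key-order (top-≡ eq w)       = top-≡ (e eq) (weight-order w)

-- The tops fix the order of the pieces in any layout, and inside a piece validity forces the order
-- of `weight`.
layout-coding : (L : Layout n) → Valid L → L ≈ˡ layout (coding L)
layout-coding L valid = record { sides = side-≡ ; order = λ s → key-< E ∘ key-order s }
  where
  E = coding L
  side-≡ : ∀ i → side L i ≡ mark L (bottom E i)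
  side-≡ i = trans (≡blockMax⇒≡side L (sym (top-bottom E i)))
                   (sym (mark-least L (bottom-least E i)))
  inner⇒ : ∀ {i} → Inner L i → InnerLabel E i
  inner⇒ x = inner⇒nonLeast L x , mark-inner L x
  inner⇐ : ∀ {i} → InnerLabel E i → Inner L i
  inner⇐ {i} (nl , l) = decidable-stable (inner? L i) λ ¬x →
    contradiction (trans (sym l) (mark-outer L nl ¬x)) λ ()
  weight-order : ∀ {i j} → blockMax L i ≡ blockMax L j → distance L i ℕ.< distance L j →
                 WeightOrder E i j
  weight-order {i} {j} eq d with inner? L i | inner? L j | Fin.<-cmp i j
  ... | _      | _      | tri≈ _ refl _ = contradiction d (ℕ.<-irrefl refl)
  ... | yes x  | no ¬y  | _            = inner-outer (inner⇒ x) (¬y ∘ inner⇐)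
  ... | yes x  | yes y  | tri> _ _ j<i = inner-inner (inner⇒ x) (inner⇒ y) j<i
  ... | no ¬x  | no ¬y  | tri< i<j _ _ = outer-outer (¬x ∘ inner⇐) (¬y ∘ inner⇐) i<j
  -- `j` is a smaller entry further out, which would make `i` inner.
  ... | no ¬x  | _      | tri> _ _ j<i = contradiction (j , j<i , sym eq , d) ¬x
  -- `j` exceeds both the nearer `i` and the further `k` of its own piece, the peak that `valid`
  -- forbids.
  ... | _      | yes (k , k<j , eq′ , d′) | tri< i<j _ _ =
    contradiction k<j (valid eq eq′ d d′ i<j)
  key-order : ∀ {i j} → side L i ≡ side L j → distance L i ℕ.< distance L j →
              KeyOrder E i j
  key-order {i} {j} s d with ℕ.m≤n⇒m<n∨m≡n (blockMax-antitone L (sym s , ℕ.<⇒≤ d))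
  ... | inj₁ lt = top-> lt
  ... | inj₂ eq = top-≡ (Fin.toℕ-injective (sym eq))
                        (weight-order (Fin.toℕ-injective (sym eq)) d)

-- Permutations from injections

subset : {P : Pred (Fin n) p} → Decidable P → Subset n
subset P? = tabulate (does ∘ P?)

∈-subset⁺ : {P : Pred (Fin n) p} (P? : Decidable P) → ∀ {i} → P i → i ∈ subset P?
∈-subset⁺ P? {i} Pi = lookup⇒[]= i _ (trans (lookup∘tabulate _ i) (dec-true (P? i) Pi))

∈-subset⁻ : {P : Pred (Fin n) p} (P? : Decidable P) → ∀ {i} → i ∈ subset P? → P i
∈-subset⁻ P? {i} i∈ with P? i | trans (sym (lookup∘tabulate (does ∘ P?) i)) ([]=⇒lookup i∈)
... | yes Pi | _ = Pi

-- Pigeonhole: if `y` were missed, punching it out would inject `Fin (suc n)` into `Fin n`.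
injective⇒surjective : (f : Fin n → Fin n) → Injective _≡_ _≡_ f → ∀ y → ∃ λ x → f x ≡ y
injective⇒surjective {suc n} f inj y = decidable-stable (Fin.any? λ x → f x Fin.≟ y) λ ∄x →
  ℕ.1+n≰n (Fin.injective⇒≤ {f = λ x → punchOut (∄x ∘ (x ,_) ∘ sym)}
    (inj ∘ Fin.punchOut-injective {i = y} _ _))

fromInjective : (f : Fin n → Fin n) → Injective _≡_ _≡_ f → Permutation′ n
fromInjective f inj = permutation f (proj₁ ∘ surj) (proj₂ ∘ surj) λ x → inj (proj₂ (surj (f x)))
  where surj = injective⇒surjective f inj

⟨$⟩ˡ-injective : (π : Permutation′ n) → Injective _≡_ _≡_ (π ⟨$⟩ˡ_)
⟨$⟩ˡ-injective π eq = trans (sym (inverseʳ π)) (trans (cong (π ⟨$⟩ʳ_) eq) (inverseʳ π))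

⟨$⟩ʳ-injective : (π : Permutation′ n) → Injective _≡_ _≡_ (π ⟨$⟩ʳ_)
⟨$⟩ʳ-injective π = ⟨$⟩ˡ-injective (flip π)

strictly-increasing⇒≥id : (f : Fin n → Fin n) → Monotonic₁ _<_ _<_ f → ∀ i → i ≤ f i
strictly-increasing⇒≥id {n} f mono i = go (toℕ i) i refl
  where
  go : ∀ k i → toℕ i ≡ k → k ℕ.≤ toℕ (f i)
  go ℕ.zero  i _  = z≤n
  go (suc k) i eq = ℕ.≤-<-trans
    (go k i′ (Fin.toℕ-fromℕ< _)) (mono (subst₂ ℕ._<_ (sym (Fin.toℕ-fromℕ< k<n)) (sym eq) ℕ.≤-refl))
    where
    k<n : k ℕ.< n
    k<n = ℕ.<-trans (ℕ.≤-reflexive (sym eq)) (Fin.toℕ<n i)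
    i′ = fromℕ< k<n

-- `π` followed by the inverse of `ρ` is increasing on positions, and so is the inverse of this map.
-- An increasing self-map of `Fin n` is at least the identity, and two mutually inverse maps with
-- this property are the identity.
order-preserving⇒≈ : (π ρ : Permutation′ n) →
  (∀ v w → π ⟨$⟩ˡ v < π ⟨$⟩ˡ w → ρ ⟨$⟩ˡ v < ρ ⟨$⟩ˡ w) →
  (∀ v w → ρ ⟨$⟩ˡ v < ρ ⟨$⟩ˡ w → π ⟨$⟩ˡ v < π ⟨$⟩ˡ w) → π Perm.≈ ρ
order-preserving⇒≈ π ρ π→ρ ρ→π i = begin
  π ⟨$⟩ʳ i                       ≡⟨ inverseʳ ρ ⟨
  ρ ⟨$⟩ʳ (ρ ⟨$⟩ˡ (π ⟨$⟩ʳ i))     ≡⟨ cong (ρ ⟨$⟩ʳ_) (fixed i) ⟩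
  ρ ⟨$⟩ʳ i                       ∎
  where
  open ≡-Reasoning
  transfer : (π ρ : Permutation′ _) →
    (∀ v w → π ⟨$⟩ˡ v < π ⟨$⟩ˡ w → ρ ⟨$⟩ˡ v < ρ ⟨$⟩ˡ w) → ∀ i → i ≤ ρ ⟨$⟩ˡ (π ⟨$⟩ʳ i)
  transfer π ρ π→ρ = strictly-increasing⇒≥id _ λ {x} {y} x<y →
    π→ρ _ _ (subst₂ _<_ (sym (inverseˡ π)) (sym (inverseˡ π)) x<y)
  fixed : ∀ i → ρ ⟨$⟩ˡ (π ⟨$⟩ʳ i) ≡ i
  fixed i = Fin.≤-antisym
    (subst (ρ ⟨$⟩ˡ (π ⟨$⟩ʳ i) ≤_) (trans (cong (π ⟨$⟩ˡ_) (inverseʳ ρ)) (inverseˡ π))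
      (transfer ρ π ρ→π (ρ ⟨$⟩ˡ (π ⟨$⟩ʳ i))))
    (transfer π ρ π→ρ i)

-- Layouts of permutations

∣-∣-sucˡ : ∀ {c q} → q ℕ.< c → ∣ q - c ∣ ≡ suc ∣ suc q - c ∣
∣-∣-sucˡ {suc c} {ℕ.zero} _       = refl
∣-∣-sucˡ {suc c} {suc q}  (s≤s l) = ∣-∣-sucˡ l

∣-∣-sucʳ : ∀ {c q} → c ℕ.≤ q → ∣ suc q - c ∣ ≡ suc ∣ q - c ∣
∣-∣-sucʳ {ℕ.zero} {ℕ.zero} _ = refl
∣-∣-sucʳ {ℕ.zero} {suc q} _  = refl
∣-∣-sucʳ {suc c} (s≤s l)     = ∣-∣-sucʳ l

∣-∣-antitoneˡ : ∀ {c q r} → q ℕ.< r → r ℕ.≤ c → ∣ r - c ∣ ℕ.< ∣ q - c ∣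
∣-∣-antitoneˡ {c} {q} {r} q<r r≤c = subst₂ ℕ._<_
  (sym (ℕ.m≤n⇒∣m-n∣≡n∸m r≤c))
  (sym (ℕ.m≤n⇒∣m-n∣≡n∸m (ℕ.<⇒≤ (ℕ.<-≤-trans q<r r≤c))))
  (ℕ.∸-monoʳ-< q<r r≤c)

∣-∣-monotoneʳ : ∀ {c q r} → c ℕ.≤ q → q ℕ.< r → ∣ q - c ∣ ℕ.< ∣ r - c ∣
∣-∣-monotoneʳ {c} {q} {r} c≤q q<r = subst₂ ℕ._<_
  (sym (ℕ.m≤n⇒∣n-m∣≡n∸m c≤q))
  (sym (ℕ.m≤n⇒∣n-m∣≡n∸m (ℕ.<⇒≤ (ℕ.≤-<-trans c≤q q<r))))
  (ℕ.∸-monoˡ-< q<r c≤q)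

-- The word that a layout describes, read from left to right, with `zero` for the maximum. The left
-- half runs inwards, so greater distances come first there.
data Before (L : Layout n) : Fin (suc n) → Fin (suc n) → Set where
  left         : ∀ {i j} → side L i ≡ 0ℙ → side L j ≡ 0ℙ →
                 distance L j ℕ.< distance L i → Before L (suc i) (suc j)
  right        : ∀ {i j} → side L i ≡ 1ℙ → side L j ≡ 1ℙ →
                 distance L i ℕ.< distance L j → Before L (suc i) (suc j)
  across       : ∀ {i j} → side L i ≡ 0ℙ → side L j ≡ 1ℙ → Before L (suc i) (suc j)
  left-centre  : ∀ {i} → side L i ≡ 0ℙ → Before L (suc i) zero
  centre-right : ∀ {i} → side L i ≡ 1ℙ → Before L zero (suc i)

before-cmp : (L : Layout n) → ∀ v w → Before L v w ⊎ v ≡ w ⊎ Before L w v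
before-cmp L zero    zero    = inj₂ (inj₁ refl)
before-cmp L zero    (suc j) with side L j in s
... | 0ℙ = inj₂ (inj₂ (left-centre s))
... | 1ℙ = inj₁ (centre-right s)
before-cmp L (suc i) zero    with side L i in s
... | 0ℙ = inj₁ (left-centre s)
... | 1ℙ = inj₂ (inj₂ (centre-right s))
before-cmp L (suc i) (suc j)
  with side L i in s | side L j in t | ℕ.<-cmp (distance L i) (distance L j)
... | 0ℙ | 1ℙ | _            = inj₁ (across s t)
... | 1ℙ | 0ℙ | _            = inj₂ (inj₂ (across t s))
... | 0ℙ | 0ℙ | tri< lt _ _  = inj₂ (inj₂ (left t s lt))
... | 0ℙ | 0ℙ | tri> _ _ gt  = inj₁ (left s t gt)
... | 1ℙ | 1ℙ | tri< lt _ _  = inj₁ (right s t lt)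
... | 1ℙ | 1ℙ | tri> _ _ gt  = inj₂ (inj₂ (right t s gt))
... | 0ℙ | 0ℙ | tri≈ _ eq _  = inj₂ (inj₁ (cong suc (injective L (trans s (sym t)) eq)))
... | 1ℙ | 1ℙ | tri≈ _ eq _  = inj₂ (inj₁ (cong suc (injective L (trans s (sym t)) eq)))

before-cong : {L M : Layout n} → L ≈ˡ M → ∀ {v w} → Before L v w → Before M v w
before-cong {L = L} {M} e = λ where
    (left s t d)     → left (sd s) (sd t) (order e (trans t (sym s)) d)
    (right s t d)    → right (sd s) (sd t) (order e (trans s (sym t)) d)
    (across s t)     → across (sd s) (sd t)
    (left-centre s)  → left-centre (sd s)
    (centre-right s) → centre-right (sd s)
  where
  sd : ∀ {i x} → side L i ≡ x → side M i ≡ x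
  sd {i} = trans (sym (sides e i))

-- The shift by one reserves 0 for the maximum, since a layout may contain distance 0.
signed : Parity → ℕ → ℤ
signed 0ℙ d = -[1+ d ]
signed 1ℙ d = + suc d

-- Positions of the entries of a layout

module _ (L : Layout n) where

  coordinate : Fin (suc n) → ℤ
  coordinate zero    = +0
  coordinate (suc i) = signed (side L i) (distance L i)

  before⇒coordinate-< : ∀ {v w} → Before L v w → coordinate v ℤ.< coordinate w
  before⇒coordinate-< (left s t d)     rewrite s | t = -<- d
  before⇒coordinate-< (right s t d)    rewrite s | t = +<+ (s≤s d)
  before⇒coordinate-< (across s t)     rewrite s | t = -<+
  before⇒coordinate-< (left-centre s)  rewrite s     = -<+
  before⇒coordinate-< (centre-right s) rewrite s     = +<+ z<s

  lower? : ∀ v → Decidable (λ w → coordinate w ℤ.< coordinate v)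
  lower? v w = coordinate w ℤ.<? coordinate v

  -- Distances may have gaps; counting the entries further left turns coordinates into the positions
  -- 0, ..., n.
  rankℕ : Fin (suc n) → ℕ
  rankℕ v = ∣ subset (lower? v) ∣

  rankℕ<1+n : ∀ v → rankℕ v ℕ.< suc n
  rankℕ<1+n v = subst (rankℕ v ℕ.<_) (Subset.∣⊤∣≡n (suc n)) (Subset.p⊂q⇒∣p∣<∣q∣
    ((λ _ → Subset.∈⊤) , v , Subset.∈⊤ , ℤ.<-irrefl refl ∘ ∈-subset⁻ (lower? v)))

  rankℕ-mono : ∀ {v w} → coordinate v ℤ.< coordinate w → rankℕ v ℕ.< rankℕ w
  rankℕ-mono {v} {w} v<w = Subset.p⊂q⇒∣p∣<∣q∣
    ( (λ u∈ → ∈-subset⁺ (lower? w) (ℤ.<-trans (∈-subset⁻ (lower? v) u∈) v<w))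
    , v , ∈-subset⁺ (lower? w) v<w , ℤ.<-irrefl refl ∘ ∈-subset⁻ (lower? v) )

  rank : Fin (suc n) → Fin (suc n)
  rank v = fromℕ< (rankℕ<1+n v)

  rank-mono : ∀ {v w} → Before L v w → rank v < rank w
  rank-mono {v} {w} b = subst₂ ℕ._<_
    (sym (Fin.toℕ-fromℕ< (rankℕ<1+n v))) (sym (Fin.toℕ-fromℕ< (rankℕ<1+n w)))
    (rankℕ-mono {v} {w} (before⇒coordinate-< b))

  rank-injective : Injective _≡_ _≡_ rank
  rank-injective {v} {w} eq with before-cmp L v w
  ... | inj₁ b           = contradiction (rank-mono b) (ℕ.<-irrefl (cong toℕ eq))
  ... | inj₂ (inj₁ v≡w)  = v≡w
  ... | inj₂ (inj₂ b)    = contradiction (rank-mono b) (ℕ.<-irrefl (cong toℕ (sym eq)))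

-- The value n, around which layouts are centred, is numbered zero, and the
-- value i < n is numbered suc i.
vertex : Fin (suc n) → Fin (suc n)
vertex {n} zero = fromℕ n
vertex (suc i)  = inject₁ i

vertex-injective : Injective _≡_ _≡_ (vertex {n})
vertex-injective {n} {zero}  {zero}  _  = refl
vertex-injective {n} {zero}  {suc j} eq = contradiction eq Fin.fromℕ≢inject₁
vertex-injective {n} {suc i} {zero}  eq = contradiction (sym eq) Fin.fromℕ≢inject₁
vertex-injective {n} {suc i} {suc j} eq = cong suc (Fin.inject₁-injective eq)

vertices : Permutation′ (suc n)
vertices = fromInjective vertex vertex-injective

vertex-suc-< : ∀ {i j : Fin n} → i < j → vertex (suc i) < vertex (suc j)
vertex-suc-< {i = i} {j} = subst₂ ℕ._<_ (sym (Fin.toℕ-inject₁ i)) (sym (Fin.toℕ-inject₁ j))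

vertex-suc-<⁻ : ∀ {i j : Fin n} → vertex (suc i) < vertex (suc j) → i < j
vertex-suc-<⁻ {i = i} {j} = subst₂ ℕ._<_ (Fin.toℕ-inject₁ i) (Fin.toℕ-inject₁ j)

vertex-zero-> : ∀ (i : Fin n) → vertex (suc i) < vertex zero
vertex-zero-> {n} i = subst (toℕ (inject₁ i) ℕ.<_) (sym (Fin.toℕ-fromℕ n)) (Fin.inject₁ℕ< i)

-- The layout of a permutation

module _ (π : Permutation′ (suc n)) where

  place : Fin (suc n) → Fin (suc n)
  place v = π ⟨$⟩ˡ vertex v

  place-injective : Injective _≡_ _≡_ place
  place-injective = vertex-injective ∘ ⟨$⟩ˡ-injective π

  at-place : ∀ v → π ⟨$⟩ʳ place v ≡ vertex v
  at-place v = inverseʳ π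

  unplace : ∀ q → ∃ λ v → place v ≡ q
  unplace q = vertices ⟨$⟩ˡ (π ⟨$⟩ʳ q) ,
    trans (cong (π ⟨$⟩ˡ_) (inverseʳ vertices)) (inverseˡ π)

  place-side : Fin n → Parity
  place-side i = if does (place (suc i) Fin.<? place zero) then 0ℙ else 1ℙ

  place-distance : Fin n → ℕ
  place-distance i = ∣ toℕ (place (suc i)) - toℕ (place zero) ∣

  place-left : ∀ {i} → place (suc i) < place zero → place-side i ≡ 0ℙ
  place-left lt = cong (if_then 0ℙ else 1ℙ) (dec-true (_ Fin.<? _) lt)

  place-right : ∀ {i} → place zero < place (suc i) → place-side i ≡ 1ℙ
  place-right gt = cong (if_then 0ℙ else 1ℙ) (dec-false (_ Fin.<? _) (ℕ.<-asym gt))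

  place-left⁻ : ∀ {i} → place-side i ≡ 0ℙ → place (suc i) < place zero
  place-left⁻ {i} s with Fin.<-cmp (place (suc i)) (place zero)
  ... | tri< lt _ _ = lt
  ... | tri≈ _ eq _ = contradiction (place-injective {suc i} {zero} eq) λ ()
  ... | tri> _ _ gt = contradiction (trans (sym s) (place-right gt)) λ ()

  place-right⁻ : ∀ {i} → place-side i ≡ 1ℙ → place zero < place (suc i)
  place-right⁻ {i} s with Fin.<-cmp (place (suc i)) (place zero)
  ... | tri< lt _ _ = contradiction (trans (sym s) (place-left lt)) λ ()
  ... | tri≈ _ eq _ = contradiction (place-injective {suc i} {zero} eq) λ ()
  ... | tri> _ _ gt = gt

  distance-left : ∀ {i j} → place-side j ≡ 0ℙ →
                  place (suc i) < place (suc j) → place-distance j ℕ.< place-distance i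
  distance-left s i<j = ∣-∣-antitoneˡ i<j (ℕ.<⇒≤ (place-left⁻ s))

  distance-right : ∀ {i j} → place-side i ≡ 1ℙ →
                   place (suc i) < place (suc j) → place-distance i ℕ.< place-distance j
  distance-right s i<j = ∣-∣-monotoneʳ (ℕ.<⇒≤ (place-right⁻ s)) i<j

  layoutOf : Layout n
  layoutOf = record
    { side      = place-side
    ; distance  = place-distance
    ; injective = inj _ refl
    }
    where
    inj : ∀ {i j} x → place-side j ≡ x → place-side i ≡ place-side j →
          place-distance i ≡ place-distance j → i ≡ j
    inj {i} {j} x t s d with Fin.<-cmp (place (suc i)) (place (suc j))
    ... | tri≈ _ eq _ = Fin.suc-injective (place-injective eq)
    inj 0ℙ t s d | tri< lt _ _ = contradiction (distance-left t lt) (ℕ.<-irrefl (sym d))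
    inj 1ℙ t s d | tri< lt _ _ = contradiction (distance-right (trans s t) lt) (ℕ.<-irrefl d)
    inj 0ℙ t s d | tri> _ _ gt = contradiction (distance-left (trans s t) gt) (ℕ.<-irrefl d)
    inj 1ℙ t s d | tri> _ _ gt = contradiction (distance-right t gt) (ℕ.<-irrefl (sym d))

  before⇒place-< : ∀ {v w} → Before layoutOf v w → place v < place w
  before⇒place-< (left {i} {j} s t d) with Fin.<-cmp (place (suc i)) (place (suc j))
  ... | tri< lt _ _ = lt
  ... | tri≈ _ eq _ = contradiction d (ℕ.<-irrefl (cong (λ q → ∣ toℕ q - toℕ (place zero) ∣) (sym eq)))
  ... | tri> _ _ gt = contradiction d (ℕ.<-asym (distance-left s gt))
  before⇒place-< (right {i} {j} s t d) with Fin.<-cmp (place (suc i)) (place (suc j))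
  ... | tri< lt _ _ = lt
  ... | tri≈ _ eq _ = contradiction d (ℕ.<-irrefl (cong (λ q → ∣ toℕ q - toℕ (place zero) ∣) eq))
  ... | tri> _ _ gt = contradiction d (ℕ.<-asym (distance-right t gt))
  before⇒place-< (across s t)     = ℕ.<-trans (place-left⁻ s) (place-right⁻ t)
  before⇒place-< (left-centre s)  = place-left⁻ s
  before⇒place-< (centre-right s) = place-right⁻ s

  place-<⇒before : ∀ {v w} → place v < place w → Before layoutOf v w
  place-<⇒before {v} {w} lt with before-cmp layoutOf v w
  ... | inj₁ b           = b
  ... | inj₂ (inj₁ refl) = contradiction lt (ℕ.<-irrefl refl)
  ... | inj₂ (inj₂ b)    = contradiction lt (ℕ.<-asym (before⇒place-< b))

-- Through `Before`, a layout retains the relative order of all positions, and that order determines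
-- the permutation.
layoutOf-injective : (π ρ : Permutation′ (suc n)) → layoutOf π ≈ˡ layoutOf ρ → π Perm.≈ ρ
layoutOf-injective π ρ e = order-preserving⇒≈ π ρ (go π ρ e) (go ρ π (≈ˡ-sym e))
  where
  go : ∀ π ρ → layoutOf π ≈ˡ layoutOf ρ → ∀ v w → π ⟨$⟩ˡ v < π ⟨$⟩ˡ w → ρ ⟨$⟩ˡ v < ρ ⟨$⟩ˡ w
  go π ρ e v w = subst₂ (λ v w → π ⟨$⟩ˡ v < π ⟨$⟩ˡ w → ρ ⟨$⟩ˡ v < ρ ⟨$⟩ˡ w)
    (inverseʳ vertices {v}) (inverseʳ vertices {w})
    (before⇒place-< ρ ∘ before-cong e ∘ place-<⇒before π
      {vertices ⟨$⟩ˡ v} {vertices ⟨$⟩ˡ w})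

layoutOf-cong : (π ρ : Permutation′ (suc n)) → π Perm.≈ ρ → layoutOf π ≈ˡ layoutOf ρ
layoutOf-cong π ρ π≈ρ = record
  { sides = λ i → cong₂ (λ q c → if does (q Fin.<? c) then 0ℙ else 1ℙ) (place-≡ (suc i)) (place-≡ zero)
  ; order = λ {i} {j} _ → subst₂ ℕ._<_ (dist-≡ i) (dist-≡ j)
  }
  where
  place-≡ : ∀ v → place π v ≡ place ρ v
  place-≡ v = ⟨$⟩ʳ-injective π (trans (at-place π v)
    (sym (trans (π≈ρ (place ρ v)) (at-place ρ v))))
  dist-≡ : ∀ i → place-distance π i ≡ place-distance ρ i
  dist-≡ i = cong₂ (λ q c → ∣ toℕ q - toℕ c ∣) (place-≡ (suc i)) (place-≡ zero)

-- `flip vertices` followed by `rank` sends values to positions; the outer `flip` turns this into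
-- the word.
arrange : Layout n → Permutation′ (suc n)
arrange L = flip (flip vertices ∘ₚ fromInjective (rank L) (rank-injective L))

place-arrange : (L : Layout n) → ∀ {v w} → Before L v w → place (arrange L) v < place (arrange L) w
place-arrange L {v} {w} = subst₂ _<_ (sym (cong (rank L) (inverseˡ vertices {v})))
  (sym (cong (rank L) (inverseˡ vertices {w}))) ∘ rank-mono L

layoutOf-arrange : (L : Layout n) → L ≈ˡ layoutOf (arrange L)
layoutOf-arrange L = record { sides = λ i → sd _ refl ; order = ord _ refl }
  where
  π = arrange L
  sd : ∀ {i} x → side L i ≡ x → side L i ≡ place-side π i
  sd 0ℙ s = trans s (sym (place-left π (place-arrange L (left-centre s))))
  sd 1ℙ s = trans s (sym (place-right π (place-arrange L (centre-right s))))
  ord : ∀ {i j} x → side L i ≡ x → side L i ≡ side L j → distance L i ℕ.< distance L j →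
        place-distance π i ℕ.< place-distance π j
  ord 0ℙ s e d = distance-left π (trans (sym (sd 0ℙ s)) s)
    (place-arrange L (left (trans (sym e) s) s d))
  ord 1ℙ s e d = distance-right π (trans (sym (sd 1ℙ s)) s)
    (place-arrange L (right s (trans (sym e) s) d))

-- Avoidance and valid layouts

steps⇒increasing : (f : Fin (suc k) → Fin n) → (∀ i → f (inject₁ i) < f (suc i)) →
                   Monotonic₁ _<_ _<_ f
steps⇒increasing f step {zero} {suc zero}     _ = step zero
steps⇒increasing f step {zero} {suc (suc j)}  _ = ℕ.<-trans (step zero)
  (steps⇒increasing (f ∘ suc) (step ∘ suc) {zero} {suc j} z<s)
steps⇒increasing {suc k} f step {suc i} {suc j} (s≤s i<j) =
  steps⇒increasing (f ∘ suc) (step ∘ suc) i<j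

module _ (π : Permutation′ n) where

  occurrence : ∀ {u l q r t} → u < l → toℕ q ≡ suc (toℕ l) → toℕ r ≡ suc (toℕ q) → r < t →
    π ⟨$⟩ʳ l < π ⟨$⟩ʳ q → π ⟨$⟩ʳ r < π ⟨$⟩ʳ q →
    π ⟨$⟩ʳ q < π ⟨$⟩ʳ u → π ⟨$⟩ʳ q < π ⟨$⟩ʳ t → Occurrence 3-121-3 π
  occurrence {u} {l} {q} {r} {t} u<l q≡ r≡ r<t πl<πq πr<πq πq<πu πq<πt = record
    { position   = lookup (u ∷ l ∷ q ∷ r ∷ t ∷ [])
    ; increasing = steps⇒increasing _ λ where
        0F → u<l
        1F → ℕ.≤-reflexive (sym q≡)
        2F → ℕ.≤-reflexive (sym r≡)
        3F → r<t
    ; ordered    = λ where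
        0F 1F _ → ℕ.<-trans πl<πq πq<πu
        0F 2F _ → πq<πu
        0F 3F _ → ℕ.<-trans πr<πq πq<πu
        2F 1F _ → πl<πq
        2F 3F _ → πr<πq
        4F 1F _ → ℕ.<-trans πl<πq πq<πt
        4F 2F _ → πq<πt
        4F 3F _ → ℕ.<-trans πr<πq πq<πt
        0F 0F 3>3 → contradiction 3>3 (ℕ.<-irrefl refl)
        0F 4F 3>3 → contradiction 3>3 (ℕ.<-irrefl refl)
        4F 0F 3>3 → contradiction 3>3 (ℕ.<-irrefl refl)
        4F 4F 3>3 → contradiction 3>3 (ℕ.<-irrefl refl)
        2F 2F 2>2 → contradiction 2>2 (ℕ.<-irrefl refl)
        2F 0F (s≤s (s≤s ()))
        2F 4F (s≤s (s≤s ()))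
        1F 0F (s≤s ())
        1F 1F (s≤s ())
        1F 2F (s≤s ())
        1F 3F (s≤s ())
        1F 4F (s≤s ())
        3F 0F (s≤s ())
        3F 1F (s≤s ())
        3F 2F (s≤s ())
        3F 3F (s≤s ())
        3F 4F (s≤s ())
    ; adjacent   = λ where
        0F ()
        1F _ → q≡
        2F _ → r≡
        3F ()
    }

  -- The largest entry between positions l and r exceeds both of its
  -- neighbours, so together with u and t it is an occurrence.
  interior-peak⇒occurrence : ∀ {u l p r t} → u < l → l < p → p < r → r < t →
    π ⟨$⟩ʳ l < π ⟨$⟩ʳ p → π ⟨$⟩ʳ r < π ⟨$⟩ʳ p →
    (∀ {q} → l ≤ q → q ≤ r → π ⟨$⟩ʳ q < π ⟨$⟩ʳ u × π ⟨$⟩ʳ q < π ⟨$⟩ʳ t) →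
    Occurrence 3-121-3 π
  interior-peak⇒occurrence {u} {l} {p} {r} {t} u<l l<p p<r r<t πl<πp πr<πp bounded
    -- `greatest` maximises an index, so the search runs over the values `v` whose position lies
    -- between `l` and `r`.
    with greatest (λ v → l Fin.≤? π ⟨$⟩ˡ v ×-dec π ⟨$⟩ˡ v Fin.≤? r)
      (π ⟨$⟩ʳ p , subst (λ q → l ≤ q × q ≤ r) (sym (inverseˡ π)) (ℕ.<⇒≤ l<p , ℕ.<⇒≤ p<r))
  ... | v , (l≤q , q≤r) , ≤v =
    occurrence (ℕ.<-≤-trans u<l l≤q⁻) q≡1+q⁻ q⁺≡1+q (ℕ.≤-<-trans q⁺≤r r<t)
      (below l≤q⁻ (ℕ.≤-trans (ℕ.<⇒≤ q⁻<q) q≤r) (ℕ.<⇒≢ q⁻<q))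
      (below (ℕ.≤-trans l≤q (ℕ.<⇒≤ q<q⁺)) q⁺≤r (ℕ.<⇒≢ q<q⁺ ∘ sym))
      (proj₁ (bounded l≤q q≤r)) (proj₂ (bounded l≤q q≤r))
    where
    q = π ⟨$⟩ˡ v
    max : ∀ {x} → l ≤ x → x ≤ r → π ⟨$⟩ʳ x ≤ v
    max l≤x x≤r = ≤v (subst (λ x → l ≤ x × x ≤ r) (sym (inverseˡ π)) (l≤x , x≤r))
    πp≤v : π ⟨$⟩ʳ p ≤ v
    πp≤v = max (ℕ.<⇒≤ l<p) (ℕ.<⇒≤ p<r)
    ≢q : ∀ {x} → π ⟨$⟩ʳ x < π ⟨$⟩ʳ p → x ≢ q
    ≢q πx<πp refl = ℕ.<⇒≱ πx<πp (subst (π ⟨$⟩ʳ p ≤_) (sym (inverseʳ π)) πp≤v)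
    l<q : l < q
    l<q = Fin.≤∧≢⇒< l≤q (≢q πl<πp)
    q<r : q < r
    q<r = Fin.≤∧≢⇒< q≤r (≢q πr<πp ∘ sym)
    below : ∀ {x} → l ≤ x → x ≤ r → toℕ x ≢ toℕ q → π ⟨$⟩ʳ x < π ⟨$⟩ʳ q
    below {x} l≤x x≤r x≢q = subst (π ⟨$⟩ʳ x <_) (sym (inverseʳ π)) (Fin.≤∧≢⇒< (max l≤x x≤r)
      λ πx≡v → x≢q (cong toℕ (trans (sym (inverseˡ π)) (cong (π ⟨$⟩ˡ_) πx≡v))))
    q⁻<n : ℕ.pred (toℕ q) ℕ.< n
    q⁻<n = ℕ.≤-<-trans ℕ.pred[n]≤n (Fin.toℕ<n q)
    q⁺<n : suc (toℕ q) ℕ.< n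
    q⁺<n = ℕ.≤-<-trans q<r (Fin.toℕ<n r)
    q⁻ = fromℕ< q⁻<n
    q⁺ = fromℕ< q⁺<n
    q⁺≡1+q : toℕ q⁺ ≡ suc (toℕ q)
    q⁺≡1+q = Fin.toℕ-fromℕ< q⁺<n
    q≡1+q⁻ : toℕ q ≡ suc (toℕ q⁻)
    q≡1+q⁻ = trans (sym (ℕ.suc-pred (toℕ q) {{ℕ.>-nonZero (ℕ.≤-<-trans z≤n l<q)}}))
                   (cong suc (sym (Fin.toℕ-fromℕ< q⁻<n)))
    q⁻<q : q⁻ < q
    q⁻<q = ℕ.≤-reflexive (sym q≡1+q⁻)
    q<q⁺ : q < q⁺
    q<q⁺ = ℕ.≤-reflexive (sym q⁺≡1+q)
    l≤q⁻ : l ≤ q⁻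
    l≤q⁻ = ℕ.s≤s⁻¹ (ℕ.≤-trans l<q (ℕ.≤-reflexive q≡1+q⁻))
    q⁺≤r : q⁺ ≤ r
    q⁺≤r = ℕ.≤-trans (ℕ.≤-reflexive q⁺≡1+q) q<r

-- Starting one step nearer, at the smaller `j`, does not change the maximum from `i` on; dropping
-- `i` does not change it either, because the larger `t` is still ahead. Hence `j`, `i` and `k`
-- share a piece.
consecutive-peak⇒¬valid : (L : Layout n) → ∀ {j i k t} →
  side L j ≡ side L i → side L k ≡ side L i → side L t ≡ side L i →
  distance L i ≡ suc (distance L j) → distance L k ≡ suc (distance L i) →
  distance L k ℕ.≤ distance L t → j < i → k < i → i < t → ¬ Valid L
consecutive-peak⇒¬valid L {j} {i} {k} {t} sj sk st di dk dt j<i k<i i<t valid =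
  valid (blockMax-unique L (trans (side-blockMax L i) (sym sj) ,
                        ℕ.≤-trans (ℕ.<⇒≤ j<ᵈi) (distance-blockMax L i)) ≤blockMax-i)
        (sym (blockMax-unique L (trans (side-blockMax L k) sk ,
                        ℕ.≤-trans (ℕ.<⇒≤ i<ᵈk) (distance-blockMax L k)) ≤blockMax-k))
        j<ᵈi i<ᵈk j<i k<i
  where
  j<ᵈi = ℕ.≤-reflexive (sym di)
  i<ᵈk = ℕ.≤-reflexive (sym dk)
  ≤blockMax-i : ∀ {m} → Beyond L j m → m ≤ blockMax L i
  ≤blockMax-i {m} (s , d) with ℕ.m≤n⇒m<n∨m≡n d
  ... | inj₁ lt = beyond⇒≤blockMax L (trans s sj , subst (ℕ._≤ distance L m) (sym di) lt)
  ... | inj₂ eq = ℕ.≤-trans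
    (ℕ.≤-trans (ℕ.≤-reflexive (cong toℕ (injective L s (sym eq)))) (ℕ.<⇒≤ j<i)) (i≤blockMax L i)
  ≤blockMax-k : ∀ {m} → Beyond L i m → m ≤ blockMax L k
  ≤blockMax-k {m} (s , d) with ℕ.m≤n⇒m<n∨m≡n d
  ... | inj₁ lt = beyond⇒≤blockMax L (trans s (sym sk) , subst (ℕ._≤ distance L m) (sym dk) lt)
  ... | inj₂ eq = ℕ.≤-trans
    (ℕ.≤-trans (ℕ.≤-reflexive (cong toℕ (injective L s (sym eq)))) (ℕ.<⇒≤ i<t))
    (beyond⇒≤blockMax L (trans st (sym sk) , dt))

module _ (π : Permutation′ (suc n)) where

  private
    L = layoutOf π

    value-< : ∀ v w → vertex v < vertex w → π ⟨$⟩ʳ place π v < π ⟨$⟩ʳ place π w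
    value-< v w = subst₂ _<_ (sym (at-place π v)) (sym (at-place π w))

    value-<⁻ : ∀ v w → π ⟨$⟩ʳ place π v < π ⟨$⟩ʳ place π w → vertex v < vertex w
    value-<⁻ v w = subst₂ _<_ (at-place π v) (at-place π w)

  -- The two 3s are the maximum of the permutation and the last entry `t` of the piece; everything
  -- from `j` to `k` is smaller than both. That `j` and `k` need not be neighbours of `i` is
  -- repaired by `interior-peak⇒occurrence`.
  avoids⇒valid : Avoids 3-121-3 π → Valid L
  avoids⇒valid avoids {i} {j} {k} ej ek dji dik j<i k<i = go (side L i) refl
    where
    t = blockMax L i
    sj = ≡blockMax⇒≡side L ej
    sk = ≡blockMax⇒≡side L ek
    st = side-blockMax L i
    -- `k` is smaller than `i`, hence not the maximum `t`, so `t` lies strictly beyond it.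
    dkt : distance L k ℕ.< distance L t
    dkt = ℕ.≤∧≢⇒<
      (subst (λ t → distance L k ℕ.≤ distance L t) ek (distance-blockMax L k))
      λ eq → ℕ.<⇒≱ k<i (ℕ.≤-trans (i≤blockMax L i) (ℕ.≤-reflexive
        (cong toℕ (sym (injective L (trans sk (sym st)) eq)))))
    between : ∀ {m} → side L m ≡ side L i → distance L j ℕ.≤ distance L m →
              distance L m ℕ.≤ distance L k → m < t
    between {m} s d d′ = Fin.≤∧≢⇒<
      (ℕ.≤-trans (beyond⇒≤blockMax L (trans s (sym sj) , d)) (ℕ.≤-reflexive (cong toℕ ej)))
      λ { refl → ℕ.<⇒≱ dkt d′ }
    go : ∀ x → side L i ≡ x → _
    -- Outwards is leftwards here: the word reads `t`, `k`, `i`, `j`, maximum.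
    go 0ℙ s = avoids (interior-peak⇒occurrence π
      (before⇒place-< π (left (trans st s) (trans sk s) dkt))
      (before⇒place-< π (left (trans sk s) s dik))
      (before⇒place-< π (left s (trans sj s) dji))
      (before⇒place-< π (left-centre (trans sj s)))
      (value-< (suc k) (suc i) (vertex-suc-< k<i)) (value-< (suc j) (suc i) (vertex-suc-< j<i))
      bounded)
      where
      bounded : ∀ {q} → place π (suc k) ≤ q → q ≤ place π (suc j) →
        π ⟨$⟩ʳ q < π ⟨$⟩ʳ place π (suc t) × π ⟨$⟩ʳ q < π ⟨$⟩ʳ place π zero
      bounded {q} k≤q q≤j with unplace π q
      ... | zero  , refl = contradiction q≤j
              (ℕ.<⇒≱ (before⇒place-< π (left-centre (trans sj s))))
      ... | suc m , refl = value-< (suc m) (suc t) (vertex-suc-< (between (trans m-left (sym s))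
                (ℕ.≮⇒≥ λ d → ℕ.<⇒≱ (before⇒place-< π (left (trans sj s) m-left d)) q≤j)
                (ℕ.≮⇒≥ λ d → ℕ.<⇒≱ (before⇒place-< π (left m-left (trans sk s) d)) k≤q)))
              , value-< (suc m) zero (vertex-zero-> m)
        where
        m-left : side L m ≡ 0ℙ
        m-left = place-left π (ℕ.≤-<-trans q≤j (before⇒place-< π (left-centre (trans sj s))))
    go 1ℙ s = avoids (interior-peak⇒occurrence π
      (before⇒place-< π (centre-right (trans sj s)))
      (before⇒place-< π (right (trans sj s) s dji))
      (before⇒place-< π (right s (trans sk s) dik))
      (before⇒place-< π (right (trans sk s) (trans st s) dkt))
      (value-< (suc j) (suc i) (vertex-suc-< j<i)) (value-< (suc k) (suc i) (vertex-suc-< k<i))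
      bounded)
      where
      bounded : ∀ {q} → place π (suc j) ≤ q → q ≤ place π (suc k) →
        π ⟨$⟩ʳ q < π ⟨$⟩ʳ place π zero × π ⟨$⟩ʳ q < π ⟨$⟩ʳ place π (suc t)
      bounded {q} j≤q q≤k with unplace π q
      ... | zero  , refl = contradiction j≤q
              (ℕ.<⇒≱ (before⇒place-< π (centre-right (trans sj s))))
      ... | suc m , refl = value-< (suc m) zero (vertex-zero-> m)
              , value-< (suc m) (suc t) (vertex-suc-< (between (trans m-right (sym s))
                (ℕ.≮⇒≥ λ d → ℕ.<⇒≱ (before⇒place-< π (right m-right (trans sj s) d)) j≤q)
                (ℕ.≮⇒≥ λ d → ℕ.<⇒≱ (before⇒place-< π (right (trans sk s) m-right d)) q≤k)))
        where
        m-right : side L m ≡ 1ℙ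
        m-right = place-right π (ℕ.<-≤-trans (before⇒place-< π (centre-right (trans sj s))) j≤q)

  -- The letters 1, 2, 1 each lie below another letter of the occurrence, so none of them is the
  -- maximum; being adjacent, they stay in one half. The 3 on the outer side keeps them in one
  -- piece.
  valid⇒avoids : Valid L → Avoids 3-121-3 π
  valid⇒avoids valid o
    with unplace π (position 0F) | unplace π (position 1F) | unplace π (position 2F)
       | unplace π (position 3F) | unplace π (position 4F)
    where open Occurrence o
  ... | v₀ , e₀ | v₁ , e₁ | v₂ , e₂ | v₃ , e₃ | v₄ , e₄ =
    go v₀ v₁ v₂ v₃ v₄
      (step 0F 1F {v₀} {v₁} (s≤s z≤n) e₀ e₁)
      (trans (cong toℕ e₂) (trans (adjacent 1F refl) (cong (suc ∘ toℕ) (sym e₁))))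
      (trans (cong toℕ e₃) (trans (adjacent 2F refl) (cong (suc ∘ toℕ) (sym e₂))))
      (step 3F 4F {v₃} {v₄} (s≤s (s≤s (s≤s (s≤s z≤n)))) e₃ e₄)
      (rel 2F 1F {v₂} {v₁} (s≤s (s≤s z≤n)) e₂ e₁)
      (rel 2F 3F {v₂} {v₃} (s≤s (s≤s z≤n)) e₂ e₃)
      (rel 0F 2F {v₀} {v₂} (s≤s (s≤s (s≤s z≤n))) e₀ e₂)
      (rel 4F 2F {v₄} {v₂} (s≤s (s≤s (s≤s z≤n))) e₄ e₂)
    where
    open Occurrence o
    step : ∀ x y {v w} → x < y → place π v ≡ position x → place π w ≡ position y →
           place π v < place π w
    step x y x<y ev ew = subst₂ _<_ (sym ev) (sym ew) (increasing x<y)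
    rel : ∀ x y {v w} → lookup (POGP.letters 3-121-3) x ℕ.> lookup (POGP.letters 3-121-3) y →
          place π v ≡ position x → place π w ≡ position y → vertex w < vertex v
    rel x y {v} {w} x>y ev ew = value-<⁻ w v (subst₂ (λ p q → π ⟨$⟩ʳ p < π ⟨$⟩ʳ q) (sym ew) (sym ev)
      (ordered x y x>y))
    zero≮ : (w : Fin (suc n)) → ¬ vertex zero < vertex w
    zero≮ w 0<w = ℕ.<⇒≱ 0<w (Fin.≤fromℕ (vertex w))
    go : ∀ v₀ v₁ v₂ v₃ v₄ →
         place π v₀ < place π v₁ →
         toℕ (place π v₂) ≡ suc (toℕ (place π v₁)) →
         toℕ (place π v₃) ≡ suc (toℕ (place π v₂)) →
         place π v₃ < place π v₄ →
         vertex v₁ < vertex v₂ → vertex v₃ < vertex v₂ →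
         vertex v₂ < vertex v₀ → vertex v₂ < vertex v₄ → ⊥
    go v₀ zero v₂ v₃ v₄ _ _ _ _ v₁<v₂ _ _ _ = zero≮ v₂ v₁<v₂
    go v₀ v₁ zero v₃ v₄ _ _ _ _ _ _ v₂<v₀ _ = zero≮ v₀ v₂<v₀
    go v₀ v₁ v₂ zero v₄ _ _ _ _ _ v₃<v₂ _ _ = zero≮ v₂ v₃<v₂
    go v₀ (suc j) (suc i) (suc k) v₄ v₀<v₁ v₂≡ v₃≡ v₃<v₄ j<i k<i v₂<v₀ v₂<v₄ =
      side-cases (side L i) refl
      where
      c = place π zero
      j≺i : place π (suc j) < place π (suc i)
      j≺i = ℕ.≤-reflexive (sym v₂≡)
      i≺k : place π (suc i) < place π (suc k)
      i≺k = ℕ.≤-reflexive (sym v₃≡)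
      ≢c : ∀ {i} → toℕ c ≢ toℕ (place π (suc i))
      ≢c {i} eq with () ← place-injective π {zero} {suc i} (Fin.toℕ-injective eq)
      side-cases : ∀ x → side L i ≡ x → ⊥
      -- On the left the nearer neighbour of the 2 is `k` and the outer 3 is `v₀`, which is not the
      -- maximum because it stands to the left of `j`.
      side-cases 0ℙ s = outward v₀ v₀<v₁ v₂<v₀
        where
        k-left : side L k ≡ 0ℙ
        k-left = place-left π (ℕ.≤∧≢⇒< (subst (ℕ._≤ toℕ c) (sym v₃≡) (place-left⁻ π s)) (≢c ∘ sym))
        j-left : side L j ≡ 0ℙ
        j-left = place-left π (ℕ.<-trans j≺i (place-left⁻ π s))
        outward : ∀ v → place π v < place π (suc j) → vertex (suc i) < vertex v → ⊥
        outward zero    lt _   = ℕ.<-asym lt (place-left⁻ π j-left)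
        outward (suc t) lt i<t = consecutive-peak⇒¬valid L
          (trans k-left (sym s)) (trans j-left (sym s))
          (trans (place-left π (ℕ.<-trans lt (place-left⁻ π j-left))) (sym s))
          (trans (∣-∣-sucˡ (place-left⁻ π s)) (cong (λ q → suc ∣ q - toℕ c ∣) (sym v₃≡)))
          (trans (∣-∣-sucˡ (place-left⁻ π j-left)) (cong (λ q → suc ∣ q - toℕ c ∣) (sym v₂≡)))
          (ℕ.<⇒≤ (distance-left π j-left lt))
          (vertex-suc-<⁻ k<i) (vertex-suc-<⁻ j<i) (vertex-suc-<⁻ i<t) valid
      side-cases 1ℙ s = outward v₄ v₃<v₄ v₂<v₄
        where
        j-right : side L j ≡ 1ℙ
        j-right = place-right π (ℕ.≤∧≢⇒<
          (ℕ.s≤s⁻¹ (subst (toℕ c ℕ.<_) v₂≡ (place-right⁻ π s))) ≢c)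
        k-right : side L k ≡ 1ℙ
        k-right = place-right π (ℕ.<-trans (place-right⁻ π s) i≺k)
        outward : ∀ v → place π (suc k) < place π v → vertex (suc i) < vertex v → ⊥
        outward zero    lt _   = ℕ.<-asym lt (place-right⁻ π k-right)
        outward (suc t) lt i<t = consecutive-peak⇒¬valid L
          (trans j-right (sym s)) (trans k-right (sym s))
          (trans (place-right π (ℕ.<-trans (place-right⁻ π k-right) lt)) (sym s))
          (trans (cong (λ q → ∣ q - toℕ c ∣) v₂≡) (∣-∣-sucʳ (ℕ.<⇒≤ (place-right⁻ π j-right))))
          (trans (cong (λ q → ∣ q - toℕ c ∣) v₃≡) (∣-∣-sucʳ (ℕ.<⇒≤ (place-right⁻ π s))))
          (ℕ.<⇒≤ (distance-right π k-right lt))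
          (vertex-suc-<⁻ j<i) (vertex-suc-<⁻ k<i) (vertex-suc-<⁻ i<t) valid

-- Partial partitions and codings

open LabeledSet using () renaming (set to ⟨_⟩; label to labelOf)
open PartialPartition using (blocks; nonempty; disjoint)

Labeled : ℕ → Set
Labeled = LabeledSet ℤ₂

infix 4 _≃_ _∈ₛ_

_≃_ : Labeled n → Labeled n → Set
_≃_ = _∼_ ℤ₂

_∈ₛ_ : Labeled n → List (Labeled n) → Set
_∈ₛ_ {n} = Membership._∈_ (labeledSetClasses ℤ₂ n)

≃-sym : {X Y : Labeled n} → X ≃ Y → Y ≃ X
≃-sym {n} {X} {Y} = ∼-sym ℤ₂ {n} {X} {Y}

≃-trans : {X Y Z : Labeled n} → X ≃ Y → Y ≃ Z → X ≃ Z
≃-trans {n} {X} {Y} {Z} = ∼-trans ℤ₂ {n} {X} {Y} {Z}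

∈-≃ : {X Y : Labeled n} → X ≃ Y → ∀ {i} → i ∈ ⟨ X ⟩ → i ∈ ⟨ Y ⟩
∈-≃ X≃Y {i} = subst (i ∈_) (proj₁ X≃Y)

∈ₛ-≃ : {X Y : Labeled n} {P : List (Labeled n)} → X ≃ Y → Y ∈ₛ P → X ∈ₛ P
∈ₛ-≃ {X = X} {Y} X≃Y = Any.map (λ {Z} → ≃-trans {X = X} {Y} {Z} X≃Y)

labelOf-cong : (X : Labeled n) → ∀ {i j} (i∈ : i ∈ ⟨ X ⟩) (j∈ : j ∈ ⟨ X ⟩) →
               i ≡ j → labelOf X i i∈ ≡ labelOf X j j∈
labelOf-cong X _ _ refl = refl

+-cancel-common : ∀ g a b → (g ℙ.+ a) ℙ.+ (g ℙ.+ b) ≡ a ℙ.+ b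
+-cancel-common 0ℙ a  b  = refl
+-cancel-common 1ℙ 0ℙ 0ℙ = refl
+-cancel-common 1ℙ 0ℙ 1ℙ = refl
+-cancel-common 1ℙ 1ℙ 0ℙ = refl
+-cancel-common 1ℙ 1ℙ 1ℙ = refl

-- In ℤ₂ a sum of two labels is their difference, which the common shift `g` cancels from. So
-- normalised labels do not depend on the representative of a class.
relative-label-≃ : (X Y : Labeled n) → X ≃ Y → ∀ {i j} →
  (i∈X : i ∈ ⟨ X ⟩) (j∈X : j ∈ ⟨ X ⟩) (i∈Y : i ∈ ⟨ Y ⟩) (j∈Y : j ∈ ⟨ Y ⟩) →
  labelOf X i i∈X ℙ.+ labelOf X j j∈X ≡ labelOf Y i i∈Y ℙ.+ labelOf Y j j∈Y
relative-label-≃ X Y (_ , g , eq) i∈X j∈X i∈Y j∈Y = trans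
  (cong₂ ℙ._+_ (eq _ i∈X i∈Y) (eq _ j∈X j∈Y)) (+-cancel-common g _ _)

-- Classes matched to the same list entry agree; matched to different entries, they would put `i`
-- into two disjoint blocks.
share⇒≃ : {xs : List (Labeled n)} → AllPairs (λ X Y → Empty (⟨ X ⟩ ∩ ⟨ Y ⟩)) xs →
          ∀ {X Y} → X ∈ₛ xs → Y ∈ₛ xs → ∀ {i} → i ∈ ⟨ X ⟩ → i ∈ ⟨ Y ⟩ → X ≃ Y
share⇒≃ (d ∷ ds) {X} {Y} (here {x} X≃x) (here Y≃x) _ _ =
  ≃-trans {X = X} {x} {Y} X≃x (≃-sym {X = Y} {x} Y≃x)
share⇒≃ (d ∷ ds) {X} {Y} (here {x} X≃x) (there Y∈) {i} i∈X i∈Y with find Y∈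
... | Z , Z∈ , Y≃Z = contradiction
  (i , Subset.x∈p∩q⁺ (∈-≃ {X = X} {x} X≃x i∈X , ∈-≃ {X = Y} {Z} Y≃Z i∈Y)) (All.lookup d Z∈)
share⇒≃ (d ∷ ds) {X} {Y} (there X∈) (here {x} Y≃x) {i} i∈X i∈Y with find X∈
... | Z , Z∈ , X≃Z = contradiction
  (i , Subset.x∈p∩q⁺ (∈-≃ {X = Y} {x} Y≃x i∈Y , ∈-≃ {X = X} {Z} X≃Z i∈X)) (All.lookup d Z∈)
share⇒≃ (d ∷ ds) (there X∈) (there Y∈) i∈X i∈Y = share⇒≃ ds X∈ Y∈ i∈X i∈Y

cover : (P : List (Labeled n)) → ∀ i →
        Dec (∃ λ X → X ∈ₛ P × i ∈ ⟨ X ⟩)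
cover P i with Any.any? (λ X → i Subset.∈? ⟨ X ⟩) P
... | yes i∈ = yes (let X , X∈P , i∈X = find i∈ in
        X , Any.map (λ { refl → ∼-refl ℤ₂ {X = X} }) X∈P , i∈X)
... | no ¬i∈ = no λ (X , X∈P , i∈X) →
        ¬i∈ (Any.map (λ {Y} X≃Y → ∈-≃ {X = X} {Y} X≃Y i∈X) X∈P)

-- t sends an element to the largest element of its block, and l is its
-- label relative to that element; a singleton block is distinguished from an
-- element in no block by its label.
record Codes (P : List (Labeled n)) (t : Fin n → Fin n) (l : Fin n → Parity) : Set where
  field
    t∈        : ∀ {X i} → X ∈ₛ P → i ∈ ⟨ X ⟩ → t i ∈ ⟨ X ⟩
    ≤t        : ∀ {X i j} → X ∈ₛ P → i ∈ ⟨ X ⟩ → j ∈ ⟨ X ⟩ → j ≤ t i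
    singleton : ∀ {X i} → X ∈ₛ P → i ∈ ⟨ X ⟩ → (∀ {j} → j ∈ ⟨ X ⟩ → j ≡ t i) → l i ≡ 1ℙ
    relative  : ∀ {X i j} → X ∈ₛ P → (i∈ : i ∈ ⟨ X ⟩) → j ∈ ⟨ X ⟩ → j ≢ t i →
                (ti∈ : t i ∈ ⟨ X ⟩) → l i ≡ labelOf X i i∈ ℙ.+ labelOf X (t i) ti∈
    t-free    : ∀ {i} → ¬ (∃ λ X → X ∈ₛ P × i ∈ ⟨ X ⟩) → t i ≡ i
    l-free    : ∀ {i} → ¬ (∃ λ X → X ∈ₛ P × i ∈ ⟨ X ⟩) → l i ≡ 0ℙ

open Codes

other? : (X : Labeled n) → ∀ m → Dec (∃ λ j → j ∈ ⟨ X ⟩ × j ≢ m)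
other? X m = Fin.any? λ j → j Subset.∈? ⟨ X ⟩ ×-dec ¬? (j Fin.≟ m)

no-other : (X : Labeled n) → ∀ {m} → ¬ (∃ λ j → j ∈ ⟨ X ⟩ × j ≢ m) → ∀ {j} → j ∈ ⟨ X ⟩ → j ≡ m
no-other X ¬o {j} j∈ = decidable-stable (j Fin.≟ _) λ j≢ → ¬o (j , j∈ , j≢)

-- `Codes` sees `P` only through `_∈ₛ_`, so equal partial partitions admit the same codings
-- (`codes-cong`); uniqueness of the coding is then the injectivity of `partition`.
codes-functional : {P : List (Labeled n)} {E F : Coding n} →
  Codes P (top E) (label E) → Codes P (top F) (label F) → E ≋ F
codes-functional {P = P} {E} {F} c d = tops , labels
  where
  tops : ∀ i → top E i ≡ top F i
  tops i with cover P i
  ... | yes (X , X∈P , i∈X) = Fin.≤-antisym (≤t d X∈P i∈X (t∈ c X∈P i∈X))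
                                            (≤t c X∈P i∈X (t∈ d X∈P i∈X))
  ... | no free = trans (t-free c free) (sym (t-free d free))
  labels : ∀ i → label E i ≡ label F i
  labels i with cover P i
  ... | no free = trans (l-free c free) (sym (l-free d free))
  ... | yes (X , X∈P , i∈X) with other? X (top E i)
  ...   | no ¬o = trans (singleton c X∈P i∈X (no-other X ¬o))
          (sym (singleton d X∈P i∈X λ j∈ → trans (no-other X ¬o j∈) (tops i)))
  ...   | yes (j , j∈X , j≢t) = trans
          (relative c X∈P i∈X j∈X j≢t (t∈ c X∈P i∈X))
          (trans (cong (labelOf X i i∈X ℙ.+_) (labelOf-cong X (t∈ c X∈P i∈X) (t∈ d X∈P i∈X) (tops i)))
                 (sym (relative d X∈P i∈X j∈X (j≢t ∘ λ e → trans e (sym (tops i))) (t∈ d X∈P i∈X))))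

codes-cong : {P Q : List (Labeled n)} {t : Fin n → Fin n} {l : Fin n → Parity} →
  (∀ {X} → X ∈ₛ P → X ∈ₛ Q) → (∀ {X} → X ∈ₛ Q → X ∈ₛ P) → Codes P t l → Codes Q t l
codes-cong P⊆Q Q⊆P c = record
  { t∈        = t∈ c ∘ Q⊆P
  ; ≤t        = ≤t c ∘ Q⊆P
  ; singleton = singleton c ∘ Q⊆P
  ; relative  = relative c ∘ Q⊆P
  ; t-free    = λ free → t-free c (free ∘ map₂ λ (X∈ , i∈) → P⊆Q X∈ , i∈)
  ; l-free    = λ free → l-free c (free ∘ map₂ λ (X∈ , i∈) → P⊆Q X∈ , i∈)
  }

-- The coding of a partial partition

module _ (P : PartialPartition ℤ₂ n) where

  private
    Covered : Fin n → Set
    Covered i = ∃ λ X → X ∈ₛ blocks P × i ∈ ⟨ X ⟩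

    share : ∀ {X Y i} → X ∈ₛ blocks P → Y ∈ₛ blocks P → i ∈ ⟨ X ⟩ → i ∈ ⟨ Y ⟩ → X ≃ Y
    share {X} {Y} X∈ Y∈ = share⇒≃ (disjoint P) {X} {Y} X∈ Y∈

    share-∈ : ∀ {X Y i} → X ∈ₛ blocks P → Y ∈ₛ blocks P → i ∈ ⟨ X ⟩ → i ∈ ⟨ Y ⟩ →
              ∀ {j} → j ∈ ⟨ X ⟩ → j ∈ ⟨ Y ⟩
    share-∈ {X} {Y} X∈ Y∈ i∈X i∈Y = ∈-≃ {X = X} {Y} (share {X} {Y} X∈ Y∈ i∈X i∈Y)

  codes⇒coding : ∀ {t l} → Codes (blocks P) t l → Coding n
  codes⇒coding {t} {l} c = record
    { top       = t
    ; label     = l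
    ; i≤top     = i≤t
    ; top-idem  = idem
    ; label-top = λ i j<t tj≡ti → label0 i j<t tj≡ti (cover (blocks P) i) (cover (blocks P) _)
    }
    where
    i≤t : ∀ i → i ≤ t i
    i≤t i with cover (blocks P) i
    ... | yes (X , X∈ , i∈) = ≤t c X∈ i∈ i∈
    ... | no free           = ℕ.≤-reflexive (cong toℕ (sym (t-free c free)))
    idem : ∀ i → t (t i) ≡ t i
    idem i with cover (blocks P) i
    ... | yes (X , X∈ , i∈) = Fin.≤-antisym
            (≤t c X∈ i∈ (t∈ c X∈ (t∈ c X∈ i∈))) (≤t c X∈ (t∈ c X∈ i∈) (t∈ c X∈ i∈))
    ... | no free           = cong t (t-free c free)
    label0 : ∀ i {j} → j < t i → t j ≡ t i → Dec (Covered i) → Dec (Covered j) → l (t i) ≡ 0ℙ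
    label0 i j<ti tj≡ti _ (no free) =
      contradiction j<ti (ℕ.<-irrefl (cong toℕ (trans (sym (t-free c free)) tj≡ti)))
    label0 i j<ti tj≡ti (no free) (yes (Z , Z∈ , j∈)) =
      contradiction (Z , Z∈ , subst (_∈ ⟨ Z ⟩) (trans tj≡ti (t-free c free)) (t∈ c Z∈ j∈)) free
    -- `j` is a second element of the block, so the label at `t i` is relative: a label added to
    -- itself.
    label0 i {j} j<ti tj≡ti (yes (X , X∈ , i∈)) (yes (Z , Z∈ , j∈)) = trans
      (relative c X∈ ti∈ j∈X (λ e → ℕ.<-irrefl (cong toℕ (trans e (idem i))) j<ti) (t∈ c X∈ ti∈))
      (trans (cong (labelOf X (t i) ti∈ ℙ.+_) (labelOf-cong X (t∈ c X∈ ti∈) ti∈ (idem i)))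
        (ℙ.p+p≡0ℙ (labelOf X (t i) ti∈)))
      where
      ti∈ = t∈ c X∈ i∈
      j∈X = share-∈ {Z} {X} Z∈ X∈ (subst (_∈ ⟨ Z ⟩) tj≡ti (t∈ c Z∈ j∈)) ti∈ j∈

  maximum : (X : Labeled n) → ∀ {i} → i ∈ ⟨ X ⟩ →
            ∃ λ m → m ∈ ⟨ X ⟩ × ∀ {j} → j ∈ ⟨ X ⟩ → j ≤ m
  maximum X i∈ = greatest (Subset._∈? ⟨ X ⟩) (_ , i∈)

  blockTop : ∀ i → Dec (Covered i) → Fin n
  blockTop i (yes (X , _ , i∈)) = proj₁ (maximum X i∈)
  blockTop i (no _)             = i

  -- Relative to its own maximum a singleton would get 0ℙ, the value of an uncovered element; 1ℙ
  -- keeps the two apart.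
  blockLabel : ∀ i → Dec (Covered i) → Parity
  blockLabel i (no _) = 0ℙ
  blockLabel i (yes (X , _ , i∈)) with maximum X i∈
  ... | m , m∈ , _ with other? X m
  ...   | yes _ = labelOf X i i∈ ℙ.+ labelOf X m m∈
  ...   | no  _ = 1ℙ

  codes-blocks : Codes (blocks P) (λ i → blockTop i (cover (blocks P) i))
                                  (λ i → blockLabel i (cover (blocks P) i))
  codes-blocks = record
    { t∈        = λ {X} {i} X∈ i∈ → top-∈ X X∈ i∈ (cover (blocks P) i)
    ; ≤t        = λ {X} {i} X∈ i∈ → ≤top X X∈ i∈ (cover (blocks P) i)
    ; singleton = λ {X} {i} X∈ i∈ → single X X∈ i∈ (cover (blocks P) i)
    ; relative  = λ {X} {i} X∈ i∈ → rel X X∈ i∈ (cover (blocks P) i)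
    ; t-free    = λ {i} free → top-free free (cover (blocks P) i)
    ; l-free    = λ {i} free → label-free free (cover (blocks P) i)
    }
    where
    module _ (X : Labeled n) {i} (X∈ : X ∈ₛ blocks P) (i∈ : i ∈ ⟨ X ⟩) where
      top-∈ : (d : Dec (Covered i)) → blockTop i d ∈ ⟨ X ⟩
      top-∈ (no free)           = contradiction (X , X∈ , i∈) free
      top-∈ (yes (Y , Y∈ , i∈Y)) =
        share-∈ {Y} {X} Y∈ X∈ i∈Y i∈ (proj₁ (proj₂ (maximum Y i∈Y)))
      ≤top : (d : Dec (Covered i)) → ∀ {j} → j ∈ ⟨ X ⟩ → j ≤ blockTop i d
      ≤top (no free)           = contradiction (X , X∈ , i∈) free
      ≤top (yes (Y , Y∈ , i∈Y)) j∈ =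
        proj₂ (proj₂ (maximum Y i∈Y)) (share-∈ {X} {Y} X∈ Y∈ i∈ i∈Y j∈)
      single : (d : Dec (Covered i)) → (∀ {j} → j ∈ ⟨ X ⟩ → j ≡ blockTop i d) → blockLabel i d ≡ 1ℙ
      single (no free)           = contradiction (X , X∈ , i∈) free
      single (yes (Y , Y∈ , i∈Y)) all≡ with maximum Y i∈Y
      ... | m , m∈ , _ with other? Y m
      ...   | yes (j , j∈ , j≢m) = contradiction (all≡ (share-∈ {Y} {X} Y∈ X∈ i∈Y i∈ j∈)) j≢m
      ...   | no _               = refl
      rel : (d : Dec (Covered i)) → ∀ {j} → j ∈ ⟨ X ⟩ → j ≢ blockTop i d →
            (ti∈ : blockTop i d ∈ ⟨ X ⟩) →
            blockLabel i d ≡ labelOf X i i∈ ℙ.+ labelOf X (blockTop i d) ti∈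
      rel (no free)           = contradiction (X , X∈ , i∈) free
      rel (yes (Y , Y∈ , i∈Y)) {j} j∈ j≢ ti∈ with maximum Y i∈Y
      ... | m , m∈ , _ with other? Y m
      ...   | yes _ = relative-label-≃ Y X (share {Y} {X} Y∈ X∈ i∈Y i∈) i∈Y m∈ i∈ ti∈
      ...   | no ¬o = contradiction (j , share-∈ {X} {Y} X∈ Y∈ i∈ i∈Y j∈ , j≢) ¬o
    top-free : ∀ {i} → ¬ Covered i → (d : Dec (Covered i)) → blockTop i d ≡ i
    top-free free (no _)  = refl
    top-free free (yes c) = contradiction c free
    label-free : ∀ {i} → ¬ Covered i → (d : Dec (Covered i)) → blockLabel i d ≡ 0ℙ
    label-free free (no _)  = refl
    label-free free (yes c) = contradiction c free

-- The partial partition of a coding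

module _ (E : Coding n) where

  block : Fin n → Labeled n
  block m = record { set = subset (λ i → top E i Fin.≟ m) ; label = λ i _ → label E i }

  ∈-block⁺ : ∀ {m i} → top E i ≡ m → i ∈ ⟨ block m ⟩
  ∈-block⁺ {m} = ∈-subset⁺ (λ i → top E i Fin.≟ m)

  ∈-block⁻ : ∀ {m i} → i ∈ ⟨ block m ⟩ → top E i ≡ m
  ∈-block⁻ {m} = ∈-subset⁻ (λ i → top E i Fin.≟ m)

  -- Among the fixed points of `top`, this rejects those with label 0ℙ and nothing below them in
  -- their piece: the elements of no block.
  IsBlock : Fin n → Set
  IsBlock m = top E m ≡ m × (label E m ≡ 1ℙ ⊎ NonLeast (top E) m)

  isBlock? : Decidable IsBlock
  isBlock? m = top E m Fin.≟ m ×-dec (label E m ℙ.≟ 1ℙ ⊎-dec nonLeast? (top E) m)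

  partition : PartialPartition ℤ₂ n
  partition = record
    { blocks   = map block (filter isBlock? (allFin n))
    ; nonempty = All.map⁺ (All.map (λ {m} (tm≡m , _) → m , ∈-block⁺ tm≡m)
                                   (All.all-filter isBlock? (allFin n)))
    ; disjoint = AllPairs.map⁺ (AllPairs.filter⁺ isBlock? (AllPairs.map disj (Unique.allFin⁺ n)))
    }
    where
    disj : ∀ {m m′} → m ≢ m′ → Empty (⟨ block m ⟩ ∩ ⟨ block m′ ⟩)
    disj m≢m′ (i , i∈) = let i∈m , i∈m′ = Subset.x∈p∩q⁻ _ _ i∈ in
      m≢m′ (trans (sym (∈-block⁻ i∈m)) (∈-block⁻ i∈m′))

  ∈-blocks⁺ : ∀ {X m} → IsBlock m → X ≃ block m → X ∈ₛ blocks partition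
  ∈-blocks⁺ ub X≃ = Any.map⁺ (lose (∈-filter⁺ isBlock? (∈-allFin _) ub) X≃)

  ∈-blocks⁻ : ∀ {X} → X ∈ₛ blocks partition → ∃ λ m → IsBlock m × X ≃ block m
  ∈-blocks⁻ X∈ with find (Any.map⁻ X∈)
  ... | m , m∈ , X≃ = m , proj₂ (∈-filter⁻ isBlock? {xs = allFin n} m∈) , X≃

  private
    ∈⇒top : ∀ {X m} → X ≃ block m → ∀ {i} → i ∈ ⟨ X ⟩ → top E i ≡ m
    ∈⇒top {X} {m} X≃ i∈ = ∈-block⁻ (∈-≃ {X = X} {block m} X≃ i∈)

    top⇒∈ : ∀ {X m} → X ≃ block m → ∀ {i} → top E i ≡ m → i ∈ ⟨ X ⟩
    top⇒∈ {X} {m} X≃ ti≡m = ∈-≃ {X = block m} {X} (≃-sym {X = X} {block m} X≃) (∈-block⁺ ti≡m)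

  codes-partition : Codes (blocks partition) (top E) (label E)
  codes-partition = record
    { t∈        = λ {X} X∈ i∈ → let m , _ , X≃ = ∈-blocks⁻ {X} X∈ in
        top⇒∈ {X} X≃ (trans (top-idem E _) (∈⇒top {X} X≃ i∈))
    ; ≤t        = λ {X} {i} {j} X∈ i∈ j∈ → let m , _ , X≃ = ∈-blocks⁻ {X} X∈ in
        subst (j ≤_) (trans (∈⇒top {X} X≃ j∈) (sym (∈⇒top {X} X≃ i∈))) (i≤top E j)
    ; singleton = λ {X} X∈ i∈ all≡ → single X (∈-blocks⁻ {X} X∈) i∈ all≡
    ; relative  = λ {X} X∈ → rel X (∈-blocks⁻ {X} X∈)
    ; t-free    = t-free′
    ; l-free    = λ {i} free → label0 free (label E i) refl
    }
    where
    single : ∀ X {i} → (∃ λ m → IsBlock m × X ≃ block m) → i ∈ ⟨ X ⟩ →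
             (∀ {j} → j ∈ ⟨ X ⟩ → j ≡ top E i) → label E i ≡ 1ℙ
    single X (m , (tm≡m , inj₁ lm≡1) , X≃) i∈ all≡ = trans
      (cong (label E) (trans (all≡ i∈) (∈⇒top {X} X≃ i∈))) lm≡1
    single X (m , (tm≡m , inj₂ (j , j<m , tj≡tm)) , X≃) i∈ all≡ = contradiction j<m
      (ℕ.<-irrefl (cong toℕ (trans (all≡ (top⇒∈ {X} X≃ (trans tj≡tm tm≡m))) (∈⇒top {X} X≃ i∈))))
    rel : ∀ X {i j} → (∃ λ m → IsBlock m × X ≃ block m) → (i∈ : i ∈ ⟨ X ⟩) → j ∈ ⟨ X ⟩ →
          j ≢ top E i → (ti∈ : top E i ∈ ⟨ X ⟩) →
          label E i ≡ labelOf X i i∈ ℙ.+ labelOf X (top E i) ti∈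
    rel X {i} {j} (m , _ , X≃) i∈ j∈ j≢ ti∈ = sym (trans
      (relative-label-≃ X (block m) X≃ i∈ ti∈ (∈-block⁺ (∈⇒top {X} X≃ i∈))
        (∈-block⁺ (∈⇒top {X} X≃ ti∈)))
      (trans (cong (label E i ℙ.+_) (label-top E i (Fin.≤∧≢⇒< j≤ j≢) tj≡ti)) (ℙ.+-identityʳ _)))
      where
      tj≡ti = trans (∈⇒top {X} X≃ j∈) (sym (∈⇒top {X} X≃ i∈))
      j≤ : j ≤ top E i
      j≤ = subst (j ≤_) tj≡ti (i≤top E j)
    ¬isBlock : ∀ {i} → ¬ (∃ λ X → X ∈ₛ blocks partition × i ∈ ⟨ X ⟩) → ¬ IsBlock (top E i)
    ¬isBlock {i} free ub = free (block (top E i) ,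
      ∈-blocks⁺ {block (top E i)} ub (∼-refl ℤ₂ {X = block (top E i)}) , ∈-block⁺ refl)
    t-free′ : ∀ {i} → ¬ (∃ λ X → X ∈ₛ blocks partition × i ∈ ⟨ X ⟩) → top E i ≡ i
    t-free′ {i} free with ℕ.m≤n⇒m<n∨m≡n (i≤top E i)
    ... | inj₁ i<t = contradiction (top-idem E i , inj₂ (i , i<t , sym (top-idem E i))) (¬isBlock free)
    ... | inj₂ i≡t = Fin.toℕ-injective (sym i≡t)
    label0 : ∀ {i} → ¬ (∃ λ X → X ∈ₛ blocks partition × i ∈ ⟨ X ⟩) →
             ∀ l → label E i ≡ l → l ≡ 0ℙ
    label0 free 0ℙ _ = refl
    label0 free 1ℙ l = contradiction
      (top-idem E _ , inj₁ (trans (cong (label E) (t-free′ free)) l)) (¬isBlock free)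

module _ (P : PartialPartition ℤ₂ n) (E : Coding n) (c : Codes (blocks P) (top E) (label E)) where

  -- The shift is forced by comparing labels at `m`. If the block has another element, `label-top`
  -- gives `label E m` the value 0ℙ, and the shift is the label that `relative` adds.
  block≃ : ∀ {Y m} → Y ∈ₛ blocks P → m ∈ ⟨ Y ⟩ → top E m ≡ m → block E m ≃ Y
  block≃ {Y} {m} Y∈ m∈ tm≡m =
    Subset.⊆-antisym (into ∘ ∈-block⁻ E) (∈-block⁺ E ∘ out) ,
    label E m ℙ.+ labelOf Y m m∈ , λ i _ i∈ → label-≡ i i∈ (i Fin.≟ m)
    where
    into : ∀ {i} → top E i ≡ m → i ∈ ⟨ Y ⟩
    into {i} ti≡m with cover (blocks P) i
    ... | no free = subst (_∈ ⟨ Y ⟩) (trans (sym ti≡m) (t-free c free)) m∈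
    ... | yes (Z , Z∈ , i∈) = ∈-≃ {X = Z} {Y} (share⇒≃ (disjoint P) {Z} {Y} Z∈ Y∈
            (subst (_∈ ⟨ Z ⟩) ti≡m (t∈ c {Z} Z∈ i∈)) m∈) i∈
    out : ∀ {i} → i ∈ ⟨ Y ⟩ → top E i ≡ m
    out {i} i∈ = Fin.≤-antisym (subst (top E i ≤_) tm≡m (≤t c {Y} Y∈ m∈ (t∈ c {Y} Y∈ i∈)))
                               (≤t c {Y} Y∈ i∈ m∈)
    label-≡ : ∀ i → (i∈ : i ∈ ⟨ Y ⟩) → Dec (i ≡ m) →
              label E i ≡ (label E m ℙ.+ labelOf Y m m∈) ℙ.+ labelOf Y i i∈
    label-≡ i i∈ (yes refl) = sym (trans (ℙ.+-assoc (label E i) _ _)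
      (trans (cong (label E i ℙ.+_) (ℙ.p+p≡0ℙ (labelOf Y i i∈))) (ℙ.+-identityʳ _)))
    label-≡ i i∈ (no i≢m) = trans
      (relative c {Y} Y∈ i∈ i∈ (i≢m ∘ λ e → trans e (out i∈)) (t∈ c {Y} Y∈ i∈))
      (trans (cong (labelOf Y i i∈ ℙ.+_) (labelOf-cong Y (t∈ c {Y} Y∈ i∈) m∈ (out i∈)))
      (trans (ℙ.+-comm (labelOf Y i i∈) _)
             (cong (λ l → (l ℙ.+ labelOf Y m m∈) ℙ.+ labelOf Y i i∈) (sym lm≡0))))
      where
      lm≡0 : label E m ≡ 0ℙ
      lm≡0 = trans (cong (label E) (sym (out i∈)))
        (label-top E i (Fin.≤∧≢⇒< (≤t c {Y} Y∈ i∈ i∈) (i≢m ∘ λ e → trans e (out i∈))) refl)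

  -- A top `m` outside all blocks of `P` has label 0ℙ and nothing below it, since an element with
  -- top `m` is either `m` or covered together with `m`; `IsBlock` excludes such an `m`.
  partition⊆ : ∀ {X} → X ∈ₛ blocks (partition E) → X ∈ₛ blocks P
  partition⊆ {X} X∈ with ∈-blocks⁻ E {X} X∈
  ... | m , (tm≡m , which) , X≃ with cover (blocks P) m
  ...   | yes (Y , Y∈ , m∈) = ∈ₛ-≃ {X = X} {Y}
          (≃-trans {X = X} {block E m} {Y} X≃ (block≃ {Y} Y∈ m∈ tm≡m)) Y∈
  ...   | no free with which
  ...     | inj₁ lm≡1 = contradiction (trans (sym lm≡1) (l-free c free)) λ ()
  ...     | inj₂ (j , j<m , tj≡tm) with cover (blocks P) j
  ...       | no j-free = contradiction j<m
              (ℕ.<-irrefl (cong toℕ (trans (sym (t-free c j-free)) (trans tj≡tm tm≡m))))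
  ...       | yes (Z , Z∈ , j∈) = contradiction
              (Z , Z∈ , subst (_∈ ⟨ Z ⟩) (trans tj≡tm tm≡m) (t∈ c {Z} Z∈ j∈)) free

  ⊆partition : ∀ {X} → X ∈ₛ blocks P → X ∈ₛ blocks (partition E)
  ⊆partition {X} X∈ with find X∈
  ... | Y , Y∈ , X≃Y with All.lookup (nonempty P) Y∈
  ...   | i , i∈Y = ∈-blocks⁺ E {X} (top-idem E i , isBlock (other? X (top E i)))
          (≃-sym {X = block E (top E i)} {X} (block≃ {X} X∈ (t∈ c {X} X∈ i∈) (top-idem E i)))
    where
    i∈ = ∈-≃ {X = Y} {X} (≃-sym {X = X} {Y} X≃Y) i∈Y
    isBlock : Dec (∃ λ j → j ∈ ⟨ X ⟩ × j ≢ top E i) →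
              label E (top E i) ≡ 1ℙ ⊎ NonLeast (top E) (top E i)
    isBlock (no ¬o) = inj₁ (singleton c {X} X∈ (t∈ c {X} X∈ i∈)
      λ j∈ → trans (no-other X ¬o j∈) (sym (top-idem E i)))
    isBlock (yes (j , j∈ , j≢)) = inj₂ (j , Fin.≤∧≢⇒< (≤t c {X} X∈ i∈ j∈) j≢ ,
      trans (Fin.≤-antisym (≤t c {X} X∈ i∈ (t∈ c {X} X∈ j∈)) (≤t c {X} X∈ j∈ (t∈ c {X} X∈ i∈)))
            (sym (top-idem E i)))

open Setoid using (_≈_)

partition-injective : (E F : Coding n) →
  _≈_ (partialPartitions ℤ₂ n) (partition E) (partition F) → E ≋ F
partition-injective E F (E⊆F , F⊆E) = codes-functional {E = E} {F} (codes-partition E)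
  (codes-cong (λ {X} → F⊆E {X}) (λ {X} → E⊆F {X}) (codes-partition F))

codes-≋ : {P : List (Labeled n)} {E F : Coding n} → E ≋ F →
  Codes P (top F) (label F) → Codes P (top E) (label E)
codes-≋ {E = E} {F} (tops , labels) c = record
  { t∈        = λ {X} {i} X∈ i∈ → subst (_∈ ⟨ X ⟩) (sym (tops i)) (t∈ c X∈ i∈)
  ; ≤t        = λ {X} {i} {j} X∈ i∈ j∈ → subst (j ≤_) (sym (tops i)) (≤t c X∈ i∈ j∈)
  ; singleton = λ {X} {i} X∈ i∈ all≡ → trans (labels i)
      (singleton c X∈ i∈ λ j∈ → trans (all≡ j∈) (tops i))
  ; relative  = λ {X} {i} X∈ i∈ j∈ j≢ ti∈ → trans (labels i)
      (trans (relative c X∈ i∈ j∈ (j≢ ∘ λ e → trans e (sym (tops i))) (t∈ c X∈ i∈))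
             (cong (labelOf X i i∈ ℙ.+_) (labelOf-cong X (t∈ c X∈ i∈) ti∈ (sym (tops i)))))
  ; t-free    = λ {i} free → trans (tops i) (t-free c free)
  ; l-free    = λ {i} free → trans (labels i) (l-free c free)
  }

-- `E` codes `partition F` because `F` does and the two agree pointwise, so both inclusions for a
-- coded partition apply.
partition-cong : {E F : Coding n} → E ≋ F →
  _≈_ (partialPartitions ℤ₂ n) (partition E) (partition F)
partition-cong {E = E} {F} E≋F =
  (λ {X} → partition⊆ (partition F) E c {X}) , (λ {X} → ⊆partition (partition F) E c {X})
  where
  c = codes-≋ {E = E} {F} E≋F (codes-partition F)

partition-surjective : (P : PartialPartition ℤ₂ n) →
  ∃ λ E → _≈_ (partialPartitions ℤ₂ n) (partition E) P
partition-surjective P = E , (λ {X} → partition⊆ P E c {X}) , (λ {X} → ⊆partition P E c {X})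
  where
  c = codes-blocks P
  E = codes⇒coding P c

-- Avoiding permutations and codings

codingOf : Permutation′ (suc n) → Coding n
codingOf π = coding (layoutOf π)

codingOf-cong : (π ρ : Permutation′ (suc n)) → π Perm.≈ ρ → codingOf π ≋ codingOf ρ
codingOf-cong π ρ π≈ρ = coding-cong (layoutOf-cong π ρ π≈ρ)

-- Avoidance makes both layouts valid, so each is recovered from the common coding.
codingOf-injective : (π ρ : Permutation′ (suc n)) →
  Avoids 3-121-3 π → Avoids 3-121-3 ρ → codingOf π ≋ codingOf ρ → π Perm.≈ ρ
codingOf-injective π ρ π-avoids ρ-avoids eq = layoutOf-injective π ρ
  (≈ˡ-trans (layout-coding (layoutOf π) (avoids⇒valid π π-avoids))
  (≈ˡ-trans (layout-cong {E = codingOf π} {codingOf ρ} eq)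
            (≈ˡ-sym (layout-coding (layoutOf ρ) (avoids⇒valid ρ ρ-avoids)))))

codingOf-surjective : (E : Coding n) → ∃ λ π → Avoids 3-121-3 π × codingOf π ≋ E
codingOf-surjective E = π ,
  valid⇒avoids π (valid-cong E≈π (valid-layout E)) ,
  ≋-trans {E = codingOf π} {coding (layout E)} {E}
    (coding-cong (≈ˡ-sym E≈π)) (coding-layout E)
  where
  π = arrange (layout E)
  E≈π = layoutOf-arrange (layout E)

corollary13 : (n : ℕ) → Bijection (avoiders 3-121-3 (suc n)) (partialPartitions ℤ₂ n)
corollary13 n = record
  { to        = λ (π , _) → partition (codingOf π)
  ; cong      = λ {(π , _)} {(ρ , _)} π≈ρ →
      partition-cong {E = codingOf π} {codingOf ρ} (codingOf-cong π ρ π≈ρ)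
  ; bijective =
      (λ {(π , π-avoids)} {(ρ , ρ-avoids)} eq →
        codingOf-injective π ρ π-avoids ρ-avoids
          (partition-injective (codingOf π) (codingOf ρ) eq))
    , λ P → let E , E≈P = partition-surjective P
                π , π-avoids , π≋E = codingOf-surjective E
            -- Surjectivity between setoids concerns the whole class of the preimage: every `ρ`
            -- equal to `π` must be sent to `P`.
            in (π , π-avoids) , λ {(ρ , _)} ρ≈π →
              Setoid.trans (partialPartitions ℤ₂ n)
                {partition (codingOf ρ)} {partition E} {P}
                (partition-cong {E = codingOf ρ} {E}
                  (≋-trans {E = codingOf ρ} {codingOf π} {E} (codingOf-cong ρ π ρ≈π) π≋E))
                E≈P
  }
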